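{- For every integer $n\geq 0$, \[ \overline{p}(5^{2}n)\equiv \overline{p}(5^{4}n) \pmod{5}. \]
   Context: An overpartition of a nonnegative integer $n$ is a partition of $n$ in which the first occurrence of each distinct part may be overlined. $\overline{p}(n)$ denotes the number of overpartitions of $n$, with $\overline{p}(0)=1$; equivalently $\sum_{n\ge0}\overline{p}(n)q^n=\prod_{k\ge1}\frac{1+q^k}{1-q^k}$. -}

module Defs where

open import Axiom.UniquenessOfIdentityProofs using (module Decidable⇒UIP)
open import Data.Bool.Base using (Bool; true; false)
import Data.Bool.Properties as Bool
open import Data.Fin.Base using (Fin; zero; suc)
open import Data.List.Base
  using (List; []; _∷_; length; lookup; map; filter; cartesianProductWith; upTo)
open import Data.List.Membership.Propositional using (_∈_; _∉_)
open import Data.List.Membership.Propositional.Properties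
  using (∈-cartesianProductWith⁺; ∈-cartesianProductWith⁻; ∈-filter⁺; ∈-filter⁻; ∈-lookup; ∈-upTo⁺)
open import Data.List.Relation.Unary.All as All using (All; []; _∷_)
open import Data.List.Relation.Unary.AllPairs using ([]; _∷_)
open import Data.List.Relation.Unary.Any using (here; there; index)
open import Data.List.Relation.Unary.Any.Properties using (lookup-index)
open import Data.List.Relation.Unary.Linked as Linked using (Linked)
open import Data.List.Relation.Unary.Unique.Propositional using (Unique)
open import Data.List.Relation.Unary.Unique.Propositional.Properties
  using (cartesianProductWith⁺; filter⁺; upTo⁺)
open import Data.Nat.Base using (ℕ; zero; suc; _≤_; _<_; z≤n; s≤s)
open import Data.Nat.ListAction using (sum)
open import Data.Nat.Properties as ℕ
  using (≤-trans; m≤m+n; m≤n+m; +-mono-≤; _<?_; _≟_)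
open import Data.Product.Base using (∃; _×_; _,_; proj₁; proj₂)
open import Data.Sum.Base using (_⊎_; inj₁; inj₂)
open import Function.Base using (_∘_)
open import Function.Bundles using (_↔_; mk↔ₛ′)
open import Relation.Binary.PropositionalEquality
  using (_≡_; refl; sym; cong; cong₂)
open import Relation.Nullary.Decidable using (Dec; _×-dec_; _⊎-dec_)
open import Relation.Nullary.Negation using (contradiction)

record Part : Set where
  constructor mkPart
  field
    size      : ℕ
    overlined : Bool

open Part public

-- The condition on consecutive parts x , y of an overpartition.  Parts are
-- listed in non-increasing order of size, so y is the first occurrence of its
-- size exactly when it is smaller than x; otherwise it cannot be overlined.
_≽_ : Part → Part → Set
x ≽ y = size y < size x ⊎ (size y ≡ size x × overlined y ≡ false)

IsOverpartition : ℕ → List Part → Set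
IsOverpartition n ps =
  All (λ p → 0 < size p) ps × Linked _≽_ ps × sum (map size ps) ≡ n

-- IsOverpartition n ps has at most one proof (see overpartition-≡), so the
-- elements of this type are the overpartitions of n, each counted once.
Overpartition : ℕ → Set
Overpartition n = ∃ (IsOverpartition n)

------------------------------------------------------------------------
-- There are finitely many overpartitions of n

≽-irrelevant : ∀ {x y} (p q : x ≽ y) → p ≡ q
≽-irrelevant (inj₁ p)       (inj₁ q)         = cong inj₁ (ℕ.<-irrelevant p q)
≽-irrelevant (inj₁ p)       (inj₂ (e , _))   = contradiction e (ℕ.<⇒≢ p)
≽-irrelevant (inj₂ (e , _)) (inj₁ q)         = contradiction e (ℕ.<⇒≢ q)
≽-irrelevant (inj₂ (e , f)) (inj₂ (e′ , f′)) =
  cong inj₂ (cong₂ _,_ (ℕ.≡-irrelevant e e′) (Decidable⇒UIP.≡-irrelevant Bool._≟_ f f′))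

overpartition-≡ : ∀ {n} {o o′ : Overpartition n} → proj₁ o ≡ proj₁ o′ → o ≡ o′
overpartition-≡ {o = ps , a , l , s} {o′ = _ , a′ , l′ , s′} refl =
  cong (ps ,_) (cong₂ _,_ (All.irrelevant ℕ.<-irrelevant a a′)
    (cong₂ _,_ (Linked.irrelevant (λ {x y} → ≽-irrelevant {x} {y}) l l′) (ℕ.≡-irrelevant s s′)))

_≽?_ : ∀ x y → Dec (x ≽ y)
x ≽? y = (size y <? size x) ⊎-dec
         ((size y ≟ size x) ×-dec (overlined y Bool.≟ false))

isOverpartition? : ∀ n ps → Dec (IsOverpartition n ps)
isOverpartition? n ps =
  All.all? (λ p → 0 <? size p) ps ×-dec
  Linked.linked? _≽?_ ps ×-dec
  (sum (map size ps) ≟ n)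

private
  bools : List Bool
  bools = false ∷ true ∷ []

  ∈-bools : ∀ b → b ∈ bools
  ∈-bools false = here refl
  ∈-bools true  = there (here refl)

  bools-unique : Unique bools
  bools-unique = ((λ ()) ∷ []) ∷ [] ∷ []

  smallParts : ℕ → List Part
  smallParts n = cartesianProductWith mkPart (upTo (suc n)) bools

  smallParts-unique : ∀ n → Unique (smallParts n)
  smallParts-unique n =
    cartesianProductWith⁺ mkPart (λ { refl → refl , refl }) (upTo⁺ (suc n)) bools-unique

  ∈-smallParts : ∀ {n} p → size p ≤ n → p ∈ smallParts n
  ∈-smallParts (mkPart s b) s≤n =
    ∈-cartesianProductWith⁺ mkPart (∈-upTo⁺ (s≤s s≤n)) (∈-bools b)

  prepend : {A : Set} → List A → List (List A) → List (List A)
  prepend = cartesianProductWith _∷_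

  -- The lists of length at most k with entries from as.
  words : {A : Set} → List A → ℕ → List (List A)
  words as zero    = [] ∷ []
  words as (suc k) = [] ∷ prepend as (words as k)

  []∉cons : ∀ {A : Set} (as : List A) wss → [] ∉ prepend as wss
  []∉cons as wss []∈ with ∈-cartesianProductWith⁻ _∷_ as wss []∈
  ... | _ , _ , _ , _ , ()

  words-unique : ∀ {A : Set} {as : List A} → Unique as → ∀ k → Unique (words as k)
  words-unique           u zero    = [] ∷ []
  words-unique {as = as} u (suc k) =
    All.tabulate (λ { w∈ refl → []∉cons as (words as k) w∈ }) ∷
    cartesianProductWith⁺ _∷_ (λ { refl → refl , refl }) u (words-unique u k)

  ∈-words : ∀ {A : Set} {as ws : List A} {k} → length ws ≤ k → All (_∈ as) ws → ws ∈ words as k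
  ∈-words {k = zero}  z≤n     []         = here refl
  ∈-words {k = suc k} z≤n     []         = here refl
  ∈-words {k = suc k} (s≤s l) (w∈ ∷ ws∈) = there (∈-cartesianProductWith⁺ _∷_ w∈ (∈-words l ws∈))

  length≤sum : ∀ {ps} → All (λ p → 0 < size p) ps → length ps ≤ sum (map size ps)
  length≤sum []        = z≤n
  length≤sum (p>0 ∷ a) = +-mono-≤ p>0 (length≤sum a)

  size≤sum : ∀ ps → All (λ p → size p ≤ sum (map size ps)) ps
  size≤sum []       = []
  size≤sum (p ∷ ps) =
    m≤m+n (size p) _ ∷ All.map (λ q≤ → ≤-trans q≤ (m≤n+m _ (size p))) (size≤sum ps)

  lookup-injective : ∀ {A : Set} {xs : List A} → Unique xs →
                     ∀ i j → lookup xs i ≡ lookup xs j → i ≡ j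
  lookup-injective (x≢ ∷ u) zero    zero    eq = refl
  lookup-injective (x≢ ∷ u) zero    (suc j) eq = contradiction eq (All.lookup x≢ (∈-lookup j))
  lookup-injective (x≢ ∷ u) (suc i) zero    eq = contradiction (sym eq) (All.lookup x≢ (∈-lookup i))
  lookup-injective (x≢ ∷ u) (suc i) (suc j) eq = cong suc (lookup-injective u i j eq)

overpartitions : ℕ → List (List Part)
overpartitions n = filter (isOverpartition? n) (words (smallParts n) n)

overpartitions-unique : ∀ n → Unique (overpartitions n)
overpartitions-unique n =
  filter⁺ (isOverpartition? n) (words-unique (smallParts-unique n) n)

overpartitions-complete : ∀ {n ps} → IsOverpartition n ps → ps ∈ overpartitions n
overpartitions-complete {ps = ps} o@(a , _ , refl) =
  ∈-filter⁺ (isOverpartition? _)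
    (∈-words (length≤sum a) (All.map (∈-smallParts _) (size≤sum ps))) o

overpartitions-sound : ∀ {n ps} → ps ∈ overpartitions n → IsOverpartition n ps
overpartitions-sound {n} = proj₂ ∘ ∈-filter⁻ (isOverpartition? n) {xs = words (smallParts n) n}

finite : ∀ n → ∃ λ k → Overpartition n ↔ Fin k
finite n = length (overpartitions n) , mk↔ₛ′ to from to∘from from∘to
  where
  to : Overpartition n → Fin (length (overpartitions n))
  to (_ , o) = index (overpartitions-complete o)

  from : Fin (length (overpartitions n)) → Overpartition n
  from i = lookup (overpartitions n) i , overpartitions-sound (∈-lookup i)

  from∘to : ∀ o → from (to o) ≡ o
  from∘to (_ , o) = overpartition-≡ (sym (lookup-index (overpartitions-complete o)))

  to∘from : ∀ i → to (from i) ≡ i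
  to∘from i = lookup-injective (overpartitions-unique n) _ _ (cong proj₁ (from∘to (from i)))

p̄ : ℕ → ℕ
p̄ n = proj₁ (finite n)

{-# OPTIONS --safe #-}

-- Write φ(q) = Σ_{x ∈ ℤ} q^{x²}, let U replace the coefficient of qⁿ by that of q⁵ⁿ and let
-- V f(q) = f(q⁵).  By Gauss, Σ p̄(n) qⁿ = 1/φ(−q), so up to the sign (−1)ⁿ, which U preserves, it
-- suffices that U⁴ Q ≡ U² Q (mod 5) for Q = 1/φ.
--
-- The only arithmetic input is r₂(5n) + r₂(n/5) = 2 r₂(n), that is U φ² + V φ² = 2 φ²: a Gaussian
-- integer of norm 5n is a multiple of 2 + i or of 2 − i, and of both exactly when 5 divides it.
-- Splitting φ = V a + q V b + q⁴ V c by exponents modulo 5, where a = U φ = V φ, this says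
-- q b c = φ² − a², and expanding the powers of φ modulo 5 gives U φ³ ≡ φ² V φ and U φ⁴ ≡ φ⁴.
-- As φ⁵ ≡ V φ, φ · U Q = U (Q V φ) ≡ U φ⁴ ≡ φ⁴, so U Q ≡ φ³ and U² Q ≡ φ² V φ.  Finally
-- U³ Q ≡ φ U φ² = 2 φ³ − φ V φ², whence U⁴ Q ≡ 2 φ² V φ − φ² U φ = φ² V φ ≡ U² Q.
module Submission where

-- Gauss's identity is obtained without infinite products. If G(n) is the generating function of
-- overpartitions into parts of size at most n, sorting by the largest part gives (1 - q^(n+1))
-- G(n+1) = (1 + q^(n+1)) G(n). From this relation and G(0) = 1, Shanks' finite identity shows that
-- G(n) times the truncated φ(-q) is 1 modulo q^n, so each coefficient of the identity is reached at
-- a finite n.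
--
-- The arithmetic of series takes place modulo 5 from the start, over natural numbers compared by
-- their remainder. Numbers of lattice points and of overpartitions, compared through explicit
-- bijections, are then coefficients as they stand, and a ring solver with coefficients modulo 5
-- expands the powers of φ. Since φ(-q) has negative coefficients and counts no set, the arithmetic
-- input is stated for φ(q), and -q is substituted for q only on the side of series.
--
-- The classes 2 and 3 are missing from the splitting of φ because the squares modulo 5 are 0, 1 and
-- 4.

open import Algebra.Bundles using (CommutativeRing)
open import Data.Nat.Base using (ℕ)
open import Level using (Level; 0ℓ)

-- Counting by duplicate-free lists

module Counting where

  open import Data.List.Base using (List; []; _∷_; length; map; filter; _++_; cartesianProduct)
  open import Data.List.Membership.Propositional using (_∈_)
  open import Data.List.Membership.Propositional.Properties
    using (∈-map⁺; ∈-map⁻; ∈-++⁺ˡ; ∈-++⁺ʳ; ∈-++⁻; ∈-filter⁺; ∈-filter⁻; ∈-cartesianProduct⁺; ∈-cartesianProduct⁻)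
  open import Data.List.Membership.Propositional.Properties.WithK using (unique∧set⇒bag)
  open import Data.List.Properties using (length-map; length-++)
  open import Data.List.Relation.Binary.BagAndSetEquality using (∼bag⇒↭)
  open import Data.List.Relation.Binary.Permutation.Propositional.Properties using (↭-length)
  open import Data.List.Relation.Unary.AllPairs using ([])
  open import Data.List.Relation.Unary.Unique.Propositional using (Unique)
  import Data.List.Relation.Unary.Unique.Propositional.Properties as Unique
  open import Data.Nat.Base using (ℕ; _+_; _*_)
  open import Data.Nat.Properties using (+-assoc; +-comm)
  open import Data.Product.Base using (∃; _×_; _,_; proj₁; proj₂)
  open import Data.Sum.Base using (_⊎_; inj₁; inj₂)
  open import Function.Bundles using (mk⇔)
  open import Relation.Binary.PropositionalEquality
  open import Relation.Nullary using (¬_; Dec; yes; no; ¬?; contradiction)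
  open import Relation.Unary using (Decidable)

  -- Points `x` are counted, not proofs of `P x`. So `P` may be an existential statement with
  -- several proofs, and transferring a count needs only implications between predicates.
  record Counts {A : Set} (P : A → Set) (c : ℕ) : Set where
    field
      elements  : List A
      unique    : Unique elements
      sound     : ∀ {x} → x ∈ elements → P x
      complete  : ∀ {x} → P x → x ∈ elements
      length≡   : length elements ≡ c

  open Counts

  private variable
    A B : Set
    P Q R : A → Set
    c d e : ℕ

  counts-unique : Counts P c → Counts P d → c ≡ d
  counts-unique p q = begin
    _                    ≡⟨ length≡ p ⟨
    length (elements p)  ≡⟨ ↭-length (∼bag⇒↭ (unique∧set⇒bag (unique p) (unique q)
                              (mk⇔ (λ x∈ → complete q (sound p x∈)) (λ x∈ → complete p (sound q x∈))))) ⟩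
    length (elements q)  ≡⟨ length≡ q ⟩
    _                    ∎
    where open ≡-Reasoning

  counts-∅ : (∀ {x} → ¬ P x) → Counts P 0
  counts-∅ ¬p = record
    { elements = [] ; unique = [] ; sound = λ () ; complete = λ p → contradiction p ¬p ; length≡ = refl }

  counts-⇔ : (∀ {x} → P x → Q x) → (∀ {x} → Q x → P x) → Counts P c → Counts Q c
  counts-⇔ f g p = record
    { elements = elements p ; unique = unique p ; sound = λ x∈ → f (sound p x∈)
    ; complete = λ q → complete p (g q) ; length≡ = length≡ p }

  counts-image : (f : A → B) → (∀ {x y} → f x ≡ f y → x ≡ y) →
                 (∀ {x} → P x → Q (f x)) → (∀ {y} → Q y → ∃ λ x → P x × y ≡ f x) →
                 Counts P c → Counts Q c
  counts-image {Q = Q} f inj to from p = record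
    { elements = map f (elements p)
    ; unique   = Unique.map⁺ inj (unique p)
    ; sound    = λ y∈ → let (x , x∈ , y≡) = ∈-map⁻ f y∈ in subst Q (sym y≡) (to (sound p x∈))
    ; complete = λ q → let (x , px , y≡) = from q in subst (_∈ _) (sym y≡) (∈-map⁺ f (complete p px))
    ; length≡  = trans (length-map f (elements p)) (length≡ p) }

  counts-⊎ : (∀ {x} → P x → ¬ Q x) → Counts P c → Counts Q d → Counts (λ x → P x ⊎ Q x) (c + d)
  counts-⊎ {P = P} {Q = Q} disj p q = record
    { elements = elements p ++ elements q
    ; unique   = Unique.++⁺ (unique p) (unique q) (λ (x∈ , x∈′) → disj (sound p x∈) (sound q x∈′))
    ; sound    = sd
    ; complete = λ { (inj₁ x) → ∈-++⁺ˡ (complete p x) ; (inj₂ x) → ∈-++⁺ʳ (elements p) (complete q x) }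
    ; length≡  = trans (length-++ (elements p)) (cong₂ _+_ (length≡ p) (length≡ q)) }
    where
    sd : ∀ {x} → x ∈ elements p ++ elements q → P x ⊎ Q x
    sd x∈ with ∈-++⁻ (elements p) x∈
    ... | inj₁ x∈ = inj₁ (sound p x∈)
    ... | inj₂ x∈ = inj₂ (sound q x∈)

  length-cartesianProduct : (xs : List A) (ys : List B) →
                            length (cartesianProduct xs ys) ≡ length xs * length ys
  length-cartesianProduct []       ys = refl
  length-cartesianProduct (x ∷ xs) ys = trans (length-++ (map (x ,_) ys))
    (cong₂ _+_ (length-map (x ,_) ys) (length-cartesianProduct xs ys))

  counts-× : Counts P c → Counts Q d → Counts (λ (x , y) → P x × Q y) (c * d)
  counts-× p q = record
    { elements = cartesianProduct (elements p) (elements q)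
    ; unique   = Unique.cartesianProduct⁺ (unique p) (unique q)
    ; sound    = λ xy∈ → let (x∈ , y∈) = ∈-cartesianProduct⁻ (elements p) (elements q) xy∈
                         in sound p x∈ , sound q y∈
    ; complete = λ (px , qy) → ∈-cartesianProduct⁺ (complete p px) (complete q qy)
    ; length≡  = trans (length-cartesianProduct (elements p) (elements q)) (cong₂ _*_ (length≡ p) (length≡ q)) }

  counts-filter : Decidable Q → Counts P c → ∃ (Counts (λ x → P x × Q x))
  counts-filter Q? p = _ , record
    { elements = filter Q? (elements p)
    ; unique   = Unique.filter⁺ Q? (unique p)
    ; sound    = λ x∈ → let (x∈ , q) = ∈-filter⁻ Q? {xs = elements p} x∈ in sound p x∈ , q
    ; complete = λ (px , q) → ∈-filter⁺ Q? (complete p px) q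
    ; length≡  = refl }

  counts-split : Decidable Q → Counts P c → Counts (λ x → P x × Q x) d →
                 Counts (λ x → P x × ¬ Q x) e → c ≡ d + e
  counts-split {Q = Q} {P = P} Q? p q r = counts-unique p
    (counts-⇔ (λ { (inj₁ (x , _)) → x ; (inj₂ (x , _)) → x })
              (λ {x} px → case px (Q? x))
              (counts-⊎ (λ (_ , y) (_ , n) → n y) q r))
    where
    case : ∀ {x} → P x → Dec (Q x) → (P x × Q x) ⊎ (P x × ¬ Q x)
    case px (yes y) = inj₁ (px , y)
    case px (no n)  = inj₂ (px , n)

  inclusion-exclusion :
    Decidable Q → (∀ {x} → P x → Q x ⊎ R x) → ∀ {c d e b} →
    Counts P b → Counts (λ x → P x × Q x) c → Counts (λ x → P x × R x) d →
    Counts (λ x → (P x × R x) × Q x) e → b + e ≡ c + d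
  inclusion-exclusion {Q = Q} {P = P} {R = R} Q? cover {c} {d} {e} {b} p pq pr prq = begin
    b + e        ≡⟨ cong (_+ e) (counts-split Q? p pq rest) ⟩
    c + k + e    ≡⟨ +-assoc c k e ⟩
    c + (k + e)  ≡⟨ cong (c +_) (trans (+-comm k e) (sym (counts-split Q? pr prq rest′))) ⟩
    c + d        ∎
    where
    open ≡-Reasoning
    k = proj₁ (counts-filter (λ x → ¬? (Q? x)) p)
    rest : Counts (λ x → P x × ¬ Q x) k
    rest = proj₂ (counts-filter (λ x → ¬? (Q? x)) p)
    resolve : ∀ {x} → Q x ⊎ R x → ¬ Q x → R x
    resolve (inj₁ q) ¬q = contradiction q ¬q
    resolve (inj₂ r) _  = r
    rest′ : Counts (λ x → (P x × R x) × ¬ Q x) k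
    rest′ = counts-⇔ (λ (px , ¬q) → (px , resolve (cover px) ¬q) , ¬q) (λ ((px , _) , ¬q) → px , ¬q) rest

-- Formal power series and the operators U, V and q ↦ aq

module PowerSeries {c ℓ : Level} (R : CommutativeRing c ℓ) where

  open import Data.Nat.Base as ℕ using (ℕ; zero; suc)
  import Data.Nat.Properties as ℕ
  open import Data.Product.Base using (_,_)
  open import Data.Nat.GeneralisedArithmetic using (fold)
  import Relation.Binary.PropositionalEquality as ≡
  private module R = CommutativeRing R
  open import Relation.Binary.Reasoning.Setoid R.setoid
  open import Algebra.Properties.CommutativeSemigroup R.+-commutativeSemigroup
    using (interchange; x∙yz≈y∙xz)
  open import Algebra.Properties.CommutativeSemigroup R.*-commutativeSemigroup
    using () renaming (x∙yz≈y∙xz to x*yz≈y*xz)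

  Series : Set c
  Series = ℕ → R.Carrier

  infix  4 _≈_
  infix  8 -_
  infixl 6 _+_
  infixl 7 _*_ _∙_

  _≈_ : Series → Series → Set ℓ
  f ≈ g = ∀ n → f n R.≈ g n

  0# 1# : Series
  0# _ = R.0#
  1# zero    = R.1#
  1# (suc _) = R.0#

  tail : Series → Series
  tail f n = f (suc n)

  -- The Cauchy product in the form f g = f₀ g + q (tail f) g, so that coefficients are given by
  -- structural recursion instead of finite sums.
  _+_ _*_ : Series → Series → Series
  (f + g) n = f n R.+ g n

  (f * g) zero    = f 0 R.* g 0
  (f * g) (suc n) = f 0 R.* g (suc n) R.+ (tail f * g) n

  -_ : Series → Series
  (- f) n = R.- f n

  _∙_ : R.Carrier → Series → Series
  (a ∙ f) n = a R.* f n

  *-cong : ∀ {f f′ g g′} → f ≈ f′ → g ≈ g′ → f * g ≈ f′ * g′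
  *-cong p q zero    = R.*-cong (p 0) (q 0)
  *-cong p q (suc n) = R.+-cong (R.*-cong (p 0) (q (suc n))) (*-cong (λ m → p (suc m)) q n)

  *-zeroˡ : ∀ f → 0# * f ≈ 0#
  *-zeroˡ f zero    = R.zeroˡ (f 0)
  *-zeroˡ f (suc n) = R.trans (R.+-cong (R.zeroˡ (f (suc n))) (*-zeroˡ f n)) (R.+-identityˡ R.0#)

  *-identityˡ : ∀ f → 1# * f ≈ f
  *-identityˡ f zero    = R.*-identityˡ (f 0)
  *-identityˡ f (suc n) =
    R.trans (R.+-cong (R.*-identityˡ (f (suc n))) (*-zeroˡ f n)) (R.+-identityʳ (f (suc n)))

  -- The recursion mirrored to the right factor; commutativity is then an induction that matches the
  -- two recursions.
  *-sucʳ : ∀ f g n → (f * g) (suc n) R.≈ f (suc n) R.* g 0 R.+ (f * tail g) n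
  *-sucʳ f g zero    = R.+-comm _ _
  *-sucʳ f g (suc n) = R.trans (R.+-congˡ (*-sucʳ (tail f) g n)) (x∙yz≈y∙xz _ _ _)

  *-comm : ∀ f g → f * g ≈ g * f
  *-comm f g zero    = R.*-comm (f 0) (g 0)
  *-comm f g (suc n) = R.trans (R.+-cong (R.*-comm _ _) (*-comm (tail f) g n)) (R.sym (*-sucʳ g f n))

  *-distribʳ-+ : ∀ h f g → (f + g) * h ≈ f * h + g * h
  *-distribʳ-+ h f g zero    = R.distribʳ _ _ _
  *-distribʳ-+ h f g (suc n) =
    R.trans (R.+-cong (R.distribʳ _ _ _) (*-distribʳ-+ h (tail f) (tail g) n)) (interchange _ _ _ _)

  ∙-assoc-* : ∀ a f g → (a ∙ f) * g ≈ a ∙ (f * g)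
  ∙-assoc-* a f g zero    = R.*-assoc _ _ _
  ∙-assoc-* a f g (suc n) =
    R.trans (R.+-cong (R.*-assoc _ _ _) (∙-assoc-* a (tail f) g n)) (R.sym (R.distribˡ _ _ _))

  *-assoc : ∀ f g h → (f * g) * h ≈ f * (g * h)
  *-assoc f g h zero    = R.*-assoc _ _ _
  *-assoc f g h (suc n) = begin
    f 0 R.* g 0 R.* h (suc n) R.+ ((f 0 ∙ tail g + tail f * g) * h) n
      ≈⟨ R.+-cong (R.*-assoc _ _ _) (*-distribʳ-+ h (f 0 ∙ tail g) (tail f * g) n) ⟩
    f 0 R.* (g 0 R.* h (suc n)) R.+ (((f 0 ∙ tail g) * h) n R.+ ((tail f * g) * h) n)
      ≈⟨ R.+-congˡ (R.+-cong (∙-assoc-* (f 0) (tail g) h n) (*-assoc (tail f) g h n)) ⟩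
    f 0 R.* (g 0 R.* h (suc n)) R.+ (f 0 R.* (tail g * h) n R.+ (tail f * (g * h)) n)
      ≈⟨ R.+-assoc _ _ _ ⟨
    f 0 R.* (g 0 R.* h (suc n)) R.+ f 0 R.* (tail g * h) n R.+ (tail f * (g * h)) n
      ≈⟨ R.+-congʳ (R.distribˡ _ _ _) ⟨
    f 0 R.* (g * h) (suc n) R.+ (tail f * (g * h)) n ∎

  commutativeRing : CommutativeRing c ℓ
  commutativeRing = record
    { Carrier = Series ; _≈_ = _≈_ ; _+_ = _+_ ; _*_ = _*_ ; -_ = -_ ; 0# = 0# ; 1# = 1#
    ; isCommutativeRing = record
      { isRing = record
        { +-isAbelianGroup = record
          { isGroup = record
            { isMonoid = record
              { isSemigroup = record
                { isMagma = record
                  { isEquivalence = record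
                    { refl  = λ _ → R.refl
                    ; sym   = λ p n → R.sym (p n)
                    ; trans = λ p q n → R.trans (p n) (q n) }
                  ; ∙-cong = λ p q n → R.+-cong (p n) (q n) }
                ; assoc = λ f g h n → R.+-assoc (f n) (g n) (h n) }
              ; identity = (λ f n → R.+-identityˡ (f n)) , (λ f n → R.+-identityʳ (f n)) }
            ; inverse = (λ f n → R.-‿inverseˡ (f n)) , (λ f n → R.-‿inverseʳ (f n))
            ; ⁻¹-cong = λ p n → R.-‿cong (p n) }
          ; comm = λ f g n → R.+-comm (f n) (g n) }
        ; *-cong = *-cong
        ; *-assoc = *-assoc
        ; *-identity = *-identityˡ , λ f n → R.trans (*-comm f 1# n) (*-identityˡ f n)
        ; distrib = (λ f g h n → R.trans (*-comm f (g + h) n)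
                      (R.trans (*-distribʳ-+ f g h n) (R.+-cong (*-comm g f n) (*-comm h f n))))
                  , *-distribʳ-+ }
      ; *-comm = *-comm } }

  -- Coefficient n of a product sees only coefficients up to n of the factors. This lets truncations
  -- stand in for limits.
  *-cong-≤ : ∀ {f f′ g g′} n → (∀ m → m ℕ.≤ n → f m R.≈ f′ m) → (∀ m → m ℕ.≤ n → g m R.≈ g′ m) →
             (f * g) n R.≈ (f′ * g′) n
  *-cong-≤ zero    p q = R.*-cong (p 0 ℕ.z≤n) (q 0 ℕ.z≤n)
  *-cong-≤ (suc n) p q = R.+-cong (R.*-cong (p 0 ℕ.z≤n) (q (suc n) ℕ.≤-refl))
    (*-cong-≤ n (λ m m≤n → p (suc m) (ℕ.s≤s m≤n)) (λ m m≤n → q m (ℕ.m≤n⇒m≤1+n m≤n)))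

  const : R.Carrier → Series
  const a zero    = a
  const a (suc _) = R.0#

  const-* : ∀ a f → const a * f ≈ a ∙ f
  const-* a f zero    = R.refl
  const-* a f (suc n) = R.trans (R.+-congˡ (*-zeroˡ f n)) (R.+-identityʳ _)

  shift : Series → Series
  shift f zero    = R.0#
  shift f (suc n) = f n

  q : Series
  q = shift 1#

  shift-cong : ∀ {f g} → f ≈ g → shift f ≈ shift g
  shift-cong p zero    = R.refl
  shift-cong p (suc n) = p n

  0+ : ∀ {a b} → R.0# R.* a R.+ b R.≈ b
  0+ = R.trans (R.+-congʳ (R.zeroˡ _)) (R.+-identityˡ _)

  shift-* : ∀ f g → shift f * g ≈ shift (f * g)
  shift-* f g zero    = R.zeroˡ (g 0)
  shift-* f g (suc n) = 0+

  q*≈shift : ∀ f → q * f ≈ shift f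
  q*≈shift f n = R.trans (shift-* 1# f n) (shift-cong (*-identityˡ f) n)

  -- f(q⁵)
  V : Series → Series
  V f 0 = f 0
  V f 1 = R.0#
  V f 2 = R.0#
  V f 3 = R.0#
  V f 4 = R.0#
  V f (suc (suc (suc (suc (suc n))))) = V (tail f) n

  U : Series → Series
  U f n = f (n ℕ.* 5)

  private
    0+4 : ∀ {a b c d e} →
          R.0# R.* a R.+ (R.0# R.* b R.+ (R.0# R.* c R.+ (R.0# R.* d R.+ e))) R.≈ e
    0+4 = R.trans 0+ (R.trans 0+ (R.trans 0+ 0+))

  V-cong : ∀ {f g} → f ≈ g → V f ≈ V g
  V-cong p 0 = p 0
  V-cong p 1 = R.refl
  V-cong p 2 = R.refl
  V-cong p 3 = R.refl
  V-cong p 4 = R.refl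
  V-cong p (suc (suc (suc (suc (suc n))))) = V-cong (λ m → p (suc m)) n

  V-+ : ∀ f g → V (f + g) ≈ V f + V g
  V-+ f g 0 = R.refl
  V-+ f g 1 = R.sym (R.+-identityˡ _)
  V-+ f g 2 = R.sym (R.+-identityˡ _)
  V-+ f g 3 = R.sym (R.+-identityˡ _)
  V-+ f g 4 = R.sym (R.+-identityˡ _)
  V-+ f g (suc (suc (suc (suc (suc n))))) = V-+ (tail f) (tail g) n

  V-∙ : ∀ a f → V (a ∙ f) ≈ a ∙ V f
  V-∙ a f 0 = R.refl
  V-∙ a f 1 = R.sym (R.zeroʳ a)
  V-∙ a f 2 = R.sym (R.zeroʳ a)
  V-∙ a f 3 = R.sym (R.zeroʳ a)
  V-∙ a f 4 = R.sym (R.zeroʳ a)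
  V-∙ a f (suc (suc (suc (suc (suc n))))) = V-∙ a (tail f) n

  V-0 : V 0# ≈ 0#
  V-0 0 = R.refl
  V-0 1 = R.refl
  V-0 2 = R.refl
  V-0 3 = R.refl
  V-0 4 = R.refl
  V-0 (suc (suc (suc (suc (suc n))))) = V-0 n

  V-* : ∀ f g → V (f * g) ≈ V f * V g
  V-* f g 0 = R.refl
  V-* f g 1 = R.sym (R.trans (R.+-cong (R.zeroʳ _) (R.zeroˡ _)) (R.+-identityˡ _))
  V-* f g 2 = R.sym (R.trans (R.+-cong (R.zeroʳ _) (R.trans 0+ (R.zeroˡ _))) (R.+-identityˡ _))
  V-* f g 3 =
    R.sym (R.trans (R.+-cong (R.zeroʳ _) (R.trans 0+ (R.trans 0+ (R.zeroˡ _)))) (R.+-identityˡ _))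
  V-* f g 4 =
    R.sym (R.trans (R.+-cong (R.zeroʳ _) (R.trans 0+ (R.trans 0+ (R.trans 0+ (R.zeroˡ _))))) (R.+-identityˡ _))
  V-* f g (suc (suc (suc (suc (suc n))))) = begin
    V (f 0 ∙ tail g + tail f * g) n                ≈⟨ V-+ (f 0 ∙ tail g) (tail f * g) n ⟩
    V (f 0 ∙ tail g) n R.+ V (tail f * g) n        ≈⟨ R.+-cong (V-∙ (f 0) (tail g) n) (V-* (tail f) g n) ⟩
    f 0 R.* V (tail g) n R.+ (V (tail f) * V g) n  ≈⟨ R.+-congˡ 0+4 ⟨
    (V f * V g) (5 ℕ.+ n)                          ∎

  U-cong : ∀ {f g} → f ≈ g → U f ≈ U g
  U-cong p n = p (n ℕ.* 5)

  U-V* : ∀ g f → U (V g * f) ≈ g * U f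
  U-V* g f zero    = R.refl
  U-V* g f (suc n) = R.+-congˡ (R.trans 0+4 (U-V* (tail g) f n))

  -- Exponents are compared five at a time: the recursive call drops five coefficients of `f`, and
  -- the local lemmas realign the shifted summands.
  dissection : ∀ f → (∀ n → f (2 ℕ.+ n ℕ.* 5) R.≈ R.0#) → (∀ n → f (3 ℕ.+ n ℕ.* 5) R.≈ R.0#) →
    f ≈ V (U f) + (shift (V (U (tail f))) + shift (shift (shift (shift (V (U (tail (tail (tail (tail f))))))))))
  dissection f f₂ f₃ = go
    where
    x+0+0 : ∀ {x} → x R.≈ x R.+ (R.0# R.+ R.0#)
    x+0+0 = R.trans (R.sym (R.+-identityʳ _)) (R.+-congˡ (R.sym (R.+-identityʳ _)))
    go : f ≈ _
    go 0 = x+0+0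
    go 1 = R.sym (R.trans (R.+-identityˡ _) (R.+-identityʳ _))
    go 2 = R.trans (f₂ 0) x+0+0
    go 3 = R.trans (f₃ 0) x+0+0
    go 4 = R.sym (R.trans (R.+-identityˡ _) (R.+-identityˡ _))
    go (suc (suc (suc (suc (suc n))))) = R.trans
      (dissection (tail (tail (tail (tail (tail f))))) (λ m → f₂ (suc m)) (λ m → f₃ (suc m)) n)
      (R.+-congˡ (R.+-cong (R.reflexive (shift-V (U (tail f)) n)) (R.reflexive (shift⁴-V (U (tail (tail (tail (tail f))))) n))))
      where
      open import Relation.Binary.PropositionalEquality.Core using (_≡_; refl)
      shift-V : ∀ g n → shift (V (tail g)) n ≡ shift (V g) (5 ℕ.+ n)
      shift-V g 0 = refl
      shift-V g (suc n) = refl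
      shift⁴-V : ∀ g n → shift (shift (shift (shift (V (tail g))))) n ≡ shift (shift (shift (shift (V g)))) (5 ℕ.+ n)
      shift⁴-V g 0 = refl
      shift⁴-V g 1 = refl
      shift⁴-V g 2 = refl
      shift⁴-V g 3 = refl
      shift⁴-V g (suc (suc (suc (suc n)))) = refl

  open import Algebra.Properties.Semiring.Exp R.semiring using (_^_; ^-congˡ; ^-assocʳ; ^-congʳ; ^-homo-*)
  open import Algebra.Properties.CommutativeSemiring.Exp R.commutativeSemiring using (^-distrib-*)

  -- The substitution of a q for q; for a = -1 it exchanges φ(q) and φ(-q).
  twist : R.Carrier → Series → Series
  twist a f n = a ^ n R.* f n

  twist-+ : ∀ a f g → twist a (f + g) ≈ twist a f + twist a g
  twist-+ a f g n = R.distribˡ _ _ _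

  private
    twist-suc : ∀ a f → tail (twist a f) ≈ a ∙ twist a (tail f)
    twist-suc a f n = R.*-assoc _ _ _

  twist-* : ∀ a f g → twist a (f * g) ≈ twist a f * twist a g
  twist-* a f g zero    = R.trans (R.*-identityˡ _)
    (R.sym (R.*-cong (R.*-identityˡ _) (R.*-identityˡ _)))
  twist-* a f g (suc n) = begin
    (a R.* a ^ n) R.* (f 0 R.* g (suc n) R.+ (tail f * g) n)
      ≈⟨ R.distribˡ _ _ _ ⟩
    (a R.* a ^ n) R.* (f 0 R.* g (suc n)) R.+ (a R.* a ^ n) R.* (tail f * g) n
      ≈⟨ R.+-cong (x*yz≈y*xz _ _ _) (R.*-assoc _ _ _) ⟩
    f 0 R.* twist a g (suc n) R.+ a R.* twist a (tail f * g) n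
      ≈⟨ R.+-cong (R.*-congʳ (R.sym (R.*-identityˡ _))) (R.*-congˡ (twist-* a (tail f) g n)) ⟩
    twist a f 0 R.* twist a g (suc n) R.+ a R.* (twist a (tail f) * twist a g) n
      ≈⟨ R.+-congˡ (R.trans (R.sym (∙-assoc-* a (twist a (tail f)) (twist a g) n))
           (*-cong (λ m → R.sym (twist-suc a f m)) (λ _ → R.refl) n)) ⟩
    (twist a f * twist a g) (suc n) ∎

  twist-1 : ∀ a → twist a 1# ≈ 1#
  twist-1 a zero    = R.*-identityˡ _
  twist-1 a (suc n) = R.zeroʳ _

  twist-cong : ∀ a {f g} → f ≈ g → twist a f ≈ twist a g
  twist-cong a f≈g n = R.*-congˡ (f≈g n)

  1^n≈1 : ∀ n → R.1# ^ n R.≈ R.1#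
  1^n≈1 zero    = R.refl
  1^n≈1 (suc n) = R.trans (R.*-identityˡ _) (1^n≈1 n)

  [a^n]²≈1 : ∀ {a} → a R.* a R.≈ R.1# → ∀ n → a ^ n R.* a ^ n R.≈ R.1#
  [a^n]²≈1 {a} a²≈1 n = R.trans (R.sym (^-distrib-* a a n)) (R.trans (^-congˡ n a²≈1) (1^n≈1 n))

  twist-involutive : ∀ {a} → a R.* a R.≈ R.1# → ∀ f → twist a (twist a f) ≈ f
  twist-involutive {a} a²≈1 f n = begin
    a ^ n R.* (a ^ n R.* f n)  ≈⟨ R.*-assoc _ _ _ ⟨
    a ^ n R.* a ^ n R.* f n    ≈⟨ R.*-congʳ ([a^n]²≈1 a²≈1 n) ⟩
    R.1# R.* f n               ≈⟨ R.*-identityˡ _ ⟩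
    f n                        ∎

  U-twist : ∀ {a} → a ^ 5 R.≈ a → ∀ f → U (twist a f) ≈ twist a (U f)
  U-twist {a} a⁵≈a f n = R.*-congʳ (begin
    a ^ (n ℕ.* 5)  ≈⟨ ^-congʳ a (ℕ.*-comm n 5) ⟩
    a ^ (5 ℕ.* n)  ≈⟨ ^-assocʳ a 5 n ⟨
    (a ^ 5) ^ n    ≈⟨ ^-congˡ n a⁵≈a ⟩
    a ^ n          ∎)

  twist-fold-shift : ∀ a k → twist a (fold 1# shift k) ≈ a ^ k ∙ fold 1# shift k
  twist-fold-shift a zero    n       = R.trans (twist-1 a n) (R.sym (R.*-identityˡ (1# n)))
  twist-fold-shift a (suc k) zero    = R.trans (R.zeroʳ _) (R.sym (R.zeroʳ _))
  twist-fold-shift a (suc k) (suc n) = begin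
    a R.* a ^ n R.* fold 1# shift k n    ≈⟨ R.*-assoc _ _ _ ⟩
    a R.* twist a (fold 1# shift k) n    ≈⟨ R.*-congˡ (twist-fold-shift a k n) ⟩
    a R.* (a ^ k R.* fold 1# shift k n)  ≈⟨ R.*-assoc _ _ _ ⟨
    a R.* a ^ k R.* fold 1# shift k n    ∎

  -- From n to n + 1 the square grows by 2 n + 1, and a^(2n) is 1.
  a^[n*n]≈a^n : ∀ {a} → a R.* a R.≈ R.1# → ∀ n → a ^ (n ℕ.* n) R.≈ a ^ n
  a^[n*n]≈a^n {a} a²≈1 zero    = R.refl
  a^[n*n]≈a^n {a} a²≈1 (suc n) = R.*-congˡ (begin
    a ^ (n ℕ.+ n ℕ.* suc n)               ≈⟨ ^-congʳ a (≡.cong (n ℕ.+_) (ℕ.*-suc n n)) ⟩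
    a ^ (n ℕ.+ (n ℕ.+ n ℕ.* n))           ≈⟨ ^-homo-* a n _ ⟩
    a ^ n R.* a ^ (n ℕ.+ n ℕ.* n)         ≈⟨ R.*-congˡ (^-homo-* a n (n ℕ.* n)) ⟩
    a ^ n R.* (a ^ n R.* a ^ (n ℕ.* n))   ≈⟨ R.*-assoc _ _ _ ⟨
    a ^ n R.* a ^ n R.* a ^ (n ℕ.* n)     ≈⟨ R.*-congʳ ([a^n]²≈1 a²≈1 n) ⟩
    R.1# R.* a ^ (n ℕ.* n)                ≈⟨ R.*-identityˡ _ ⟩
    a ^ (n ℕ.* n)                         ≈⟨ a^[n*n]≈a^n a²≈1 n ⟩
    a ^ n                                 ∎)

  -- Σ q^{x²} over the integers x with |x| ≤ N
  truncatedTheta : ℕ → Series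
  truncatedTheta zero    = 1#
  truncatedTheta (suc N) = truncatedTheta N + (δ + δ)
    where δ = fold 1# shift (suc N ℕ.* suc N)

-- Polynomial identities in characteristic 5

CharacteristicDivides : ∀ {c ℓ} → ℕ → CommutativeRing c ℓ → Set ℓ
CharacteristicDivides n K = n × 1# ≈ 0#
  where
  open CommutativeRing K
  open import Algebra.Properties.Semiring.Mult semiring using (_×_)

-- The product of Σ aᵢqⁱ and Σ bᵢqⁱ (i < 5) modulo q⁵ = t.
module Cyclic {a} {A : Set a} (_+_ _*_ : A → A → A) (0# : A) where

  open import Data.Vec.Base using (Vec; []; _∷_; zipWith; map)

  -- Multiplication by q: the overflow b₄ q⁵ becomes t b₄ in degree 0.
  rotate : A → Vec A 5 → Vec A 5
  rotate t (b₀ ∷ b₁ ∷ b₂ ∷ b₃ ∷ b₄ ∷ []) = (t * b₄) ∷ b₀ ∷ b₁ ∷ b₂ ∷ b₃ ∷ []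

  -- Each later coefficient on the left meets the right factor multiplied by one more q; the
  -- recursion is the reason for the arbitrary left length. The ring operations are parameters so
  -- that the same definition also runs on the polynomials of the solver.
  _⊛[_]_ : ∀ {n} → Vec A n → A → Vec A 5 → Vec A 5
  []       ⊛[ t ] bs = 0# ∷ 0# ∷ 0# ∷ 0# ∷ 0# ∷ []
  (a ∷ as) ⊛[ t ] bs = zipWith _+_ (map (a *_) bs) (as ⊛[ t ] rotate t bs)

module Characteristic5 {c ℓ : Level} (K : CommutativeRing c ℓ)
  (5≈0 : CharacteristicDivides 5 K) where

  open import Algebra.Bundles using (RawRing)
  open import Algebra.Solver.Ring.AlmostCommutativeRing using (fromCommutativeRing; _-Raw-AlmostCommutative⟶_)
  import Algebra.Solver.Ring
  open import Data.Maybe.Base using (Maybe; just; nothing)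
  open import Data.Nat.Base as ℕ using (ℕ)
  import Data.Nat.DivMod as ℕ
  import Data.Nat.Properties as ℕ
  open import Data.Vec.Base using (Vec; []; _∷_; head)
  open import Relation.Binary.PropositionalEquality as ≡ using (_≡_)
  open import Relation.Nullary using (yes; no)
  open CommutativeRing K
  open import Algebra.Properties.Semiring.Mult semiring
  open import Algebra.Properties.Semiring.Exp semiring using (_^_)
  open import Relation.Binary.Reasoning.Setoid setoid

  private
    -- Coefficients for the ring solver. Its operations reduce modulo 5, so that multiples of 5
    -- vanish from normal forms, such as the inner binomial coefficients of (a + x)⁵.
    ℤ/5 : RawRing _ _
    ℤ/5 = record
      { Carrier = ℕ ; _≈_ = _≡_ ; _+_ = λ m n → (m ℕ.+ n) ℕ.% 5 ; _*_ = λ m n → (m ℕ.* n) ℕ.% 5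
      ; -_ = λ m → (4 ℕ.* m) ℕ.% 5 ; 0# = 0 ; 1# = 1 }

    multiple : ∀ n → (n ℕ.* 5) × 1# ≈ 0#
    multiple n = begin
      (n ℕ.* 5) × 1#         ≈⟨ ×1-homo-* n 5 ⟩
      (n × 1#) * (5 × 1#)    ≈⟨ *-congˡ 5≈0 ⟩
      (n × 1#) * 0#          ≈⟨ zeroʳ _ ⟩
      0#                     ∎

    reduce : ∀ n → (n ℕ.% 5) × 1# ≈ n × 1#
    reduce n = begin
      (n ℕ.% 5) × 1#                            ≈⟨ +-identityʳ _ ⟨
      (n ℕ.% 5) × 1# + 0#                       ≈⟨ +-congˡ (multiple (n ℕ./ 5)) ⟨
      (n ℕ.% 5) × 1# + (n ℕ./ 5 ℕ.* 5) × 1#     ≈⟨ ×-homo-+ 1# (n ℕ.% 5) _ ⟨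
      (n ℕ.% 5 ℕ.+ n ℕ./ 5 ℕ.* 5) × 1#          ≡⟨ ≡.cong (_× 1#) (ℕ.m≡m%n+[m/n]*n n 5) ⟨
      n × 1#                                    ∎

    4×-inverse : ∀ n → (4 ℕ.* n) × 1# ≈ - (n × 1#)
    4×-inverse n = begin
      x                      ≈⟨ +-identityˡ _ ⟨
      0# + x                 ≈⟨ +-congʳ (-‿inverseˡ y) ⟨
      (- y + y) + x          ≈⟨ +-assoc _ _ _ ⟩
      - y + (y + x)          ≈⟨ +-congˡ (×-homo-+ 1# n (4 ℕ.* n)) ⟨
      - y + (5 ℕ.* n) × 1#   ≡⟨ ≡.cong (λ k → - y + k × 1#) (ℕ.*-comm 5 n) ⟩
      - y + (n ℕ.* 5) × 1#   ≈⟨ +-congˡ (multiple n) ⟩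
      - y + 0#               ≈⟨ +-identityʳ _ ⟩
      - y                    ∎
      where
      x = (4 ℕ.* n) × 1#
      y = n × 1#

    morphism : ℤ/5 -Raw-AlmostCommutative⟶ fromCommutativeRing K
    morphism = record
      { ⟦_⟧    = _× 1#
      ; +-homo = λ m n → trans (reduce (m ℕ.+ n)) (×-homo-+ 1# m n)
      ; *-homo = λ m n → trans (reduce (m ℕ.* n)) (×1-homo-* m n)
      ; -‿homo = λ n → trans (reduce (4 ℕ.* n)) (4×-inverse n)
      ; 0-homo = refl
      ; 1-homo = ×-homo-1 1# }

    decide : ∀ m n → Maybe (m × 1# ≈ n × 1#)
    decide m n with m ℕ.≟ n
    ... | yes m≡n = just (reflexive (≡.cong (_× 1#) m≡n))
    ... | no _    = nothing

  open Algebra.Solver.Ring ℤ/5 (fromCommutativeRing K) morphism decide public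
    using (solve; _:=_; _:+_; _:*_; :-_; _:-_; _:^_; con; Polynomial)

  frobenius-+ : ∀ a x → (a + x) ^ 5 ≈ a ^ 5 + x ^ 5
  frobenius-+ = solve 2 (λ a x → (a :+ x) :^ 5 := a :^ 5 :+ x :^ 5) refl

  horner-rotate : ∀ x a b c d e →
    x ^ 5 * e + x * (a + x * (b + x * (c + x * (d + x * 0#)))) ≈
    x * (a + x * (b + x * (c + x * (d + x * (e + x * 0#)))))
  horner-rotate = solve 6 (λ x a b c d e →
    x :^ 5 :* e :+ x :* (a :+ x :* (b :+ x :* (c :+ x :* (d :+ x :* con 0)))) :=
    x :* (a :+ x :* (b :+ x :* (c :+ x :* (d :+ x :* (e :+ x :* con 0)))))) refl

  horner-expand : ∀ x a b c d e →
    a + x * (b + x * (c + x * (d + x * (e + x * 0#)))) ≈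
    a + b * x ^ 1 + c * x ^ 2 + d * x ^ 3 + e * x ^ 4
  horner-expand = solve 6 (λ x a b c d e →
    a :+ x :* (b :+ x :* (c :+ x :* (d :+ x :* (e :+ x :* con 0)))) :=
    a :+ b :* x :^ 1 :+ c :* x :^ 2 :+ d :* x :^ 3 :+ e :* x :^ 4) refl

  horner-sparse : ∀ x a b c → a + (x * b + x * (x * (x * (x * c)))) ≈
    a + x * (b + x * (0# + x * (0# + x * (c + x * 0#))))
  horner-sparse = solve 4 (λ x a b c → a :+ (x :* b :+ x :* (x :* (x :* (x :* c)))) :=
    a :+ x :* (b :+ x :* (con 0 :+ x :* (con 0 :+ x :* (c :+ x :* con 0))))) refl

  regroup : ∀ x y → (x + y) + (x + y) ≈ (x + (y + y)) + x
  regroup = solve 2 (λ x y → (x :+ y) :+ (x :+ y) := (x :+ (y :+ y)) :+ x) refl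

  rotate-product : ∀ x y z → x * (y * z) ≈ z * x * y
  rotate-product = solve 3 (λ x y z → x :* (y :* z) := z :* x :* y) refl

  split-power : ∀ x y → x ^ 5 * y ≈ x * x * (x * x) * (y * x)
  split-power = solve 2 (λ x y → x :^ 5 :* y := x :* x :* (x :* x) :* (y :* x)) refl

  split-last : ∀ x y → x * x * (x * x) * y ≈ x * x * x * (y * x)
  split-last = solve 2 (λ x y → x :* x :* (x :* x) :* y := x :* x :* x :* (y :* x)) refl

  isolate : ∀ x y z → x * y ≈ x * (y + z) - z * x
  isolate = solve 3 (λ x y z → x :* y := x :* (y :+ z) :- z :* x) refl

  double : ∀ x → x * (x * x + x * x) ≈ x * x * x + x * x * x
  double = solve 1 (λ x → x :* (x :* x :+ x :* x) := x :* x :* x :+ x :* x :* x) refl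

  cancel : ∀ x y → x * y + x * y - y * x ≈ x * y
  cancel = solve 2 (λ x y → x :* y :+ x :* y :- y :* x := x :* y) refl

  private
    -- The solver proves identities but takes no hypotheses. A consequence l ≈ r is therefore
    -- certified by the identity l - u = r - v, where u ≈ v is a linear combination of the
    -- hypotheses.
    combine : ∀ {u v l r} → u ≈ v → l - u ≈ r - v → l ≈ r
    combine {u} {v} {l} {r} u≈v eq = begin
      l          ≈⟨ add-back l u ⟨
      l - u + u  ≈⟨ +-cong eq u≈v ⟩
      r - v + v  ≈⟨ add-back r v ⟩
      r          ∎
      where
      add-back : ∀ x y → x - y + y ≈ x
      add-back = solve 2 (λ x y → x :- y :+ y := x) refl

  difference : ∀ y f g → f - y * f ≈ g - y * g → f - g ≈ y * (f - g)
  difference y f g h = combine h (identity y f g)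
    where
    identity : ∀ y f g → _
    identity = solve 3 (λ y f g → f :- g :- (f :- y :* f) := y :* (f :- g) :- (g :- y :* g)) refl

  -- Elimination of `h`: the first hypothesis times 1 - y, plus the second times 2 y.
  largest-part : ∀ {y g g′ h} → g′ ≈ g + (y * h + y * h) → h ≈ g + y * h → g′ - y * g′ ≈ g + y * g
  largest-part {y} {g} {g′} {h} h₁ h₂ =
    combine (+-cong (+-cong h₁ (*-congˡ {x = - y} h₁)) (*-congˡ {x = y + y} h₂)) (identity y g g′ h)
    where
    identity : ∀ y g g′ h → _
    identity = solve 4 (λ y g g′ h → let e = g :+ (y :* h :+ y :* h) in
      g′ :- y :* g′ :- (g′ :+ (:- y) :* g′ :+ (y :+ y) :* h) :=
      g :+ y :* g :- (e :+ (:- y) :* e :+ (y :+ y) :* (g :+ y :* h))) refl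

  telescope-base : ∀ y g → g - y * g + (y * g + y * g) ≈ g + y * g
  telescope-base = solve 2 (λ y g → g :- y :* g :+ (y :* g :+ y :* g) := g :+ y :* g) refl

  -- The second hypothesis says of the increment d = g′ - g both that (1 - w) d = 2 w g and that (1
  -- + w) d = 2 w g′. The new summands of the two sides need these with factors σ z and σ z y, which
  -- gives the multiplier `σ * z + σ * z * y`.
  telescope-step : ∀ {σ y z w g g′ t t′} →
    t′ - y * t′ + (σ * ((w * z) * g) + σ * ((w * z) * g)) ≈ t + y * t →
    g′ - w * g′ ≈ g + w * g →
    (t′ + - σ * ((w * z) * (g′ - g))) - y * (t′ + - σ * ((w * z) * (g′ - g)))
      + (- σ * ((y * (w * z)) * g′) + - σ * ((y * (w * z)) * g′))
    ≈ (t + - σ * (z * (g′ - g))) + y * (t + - σ * (z * (g′ - g)))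
  telescope-step {σ} {y} {z} {w} {g} {g′} {t} {t′} h₁ h₂ =
    combine (+-cong h₁ (*-congˡ {x = σ * z + σ * z * y} h₂)) (identity σ y z w g g′ t t′)
    where
    identity : ∀ σ y z w g g′ t t′ → _
    identity = solve 8 (λ σ y z w g g′ t t′ →
      let u = t′ :+ (:- σ) :* ((w :* z) :* (g′ :- g))
          v = t :+ (:- σ) :* (z :* (g′ :- g))
          k = σ :* z :+ σ :* z :* y
          r = σ :* ((w :* z) :* g)
          r′ = (:- σ) :* ((y :* (w :* z)) :* g′)
      in (u :- y :* u :+ (r′ :+ r′)) :- ((t′ :- y :* t′ :+ (r :+ r)) :+ k :* (g′ :- w :* g′))
      := v :+ y :* v :- ((t :+ y :* t) :+ k :* (g :+ w :* g))) refl

  -- The hypotheses enter with multipliers 1, `- s + σ * x` and 1 + y. Both sides of the conclusion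
  -- keep the factor 1 - y, which is to be cancelled afterwards.
  gauss-step : ∀ {σ x y g g′ s t t′} →
    t′ - y * t′ + (σ * (x * g) + σ * (x * g)) ≈ t + y * t →
    g′ - y * g′ ≈ g + y * g →
    t ≈ s * g →
    let u = t′ + - σ * (x * (g′ - g)); v = (s + (- σ * x + - σ * x)) * g′ in u - y * u ≈ v - y * v
  gauss-step {σ} {x} {y} {g} {g′} {s} {t} {t′} h₁ h₂ h₃ =
    combine (+-cong h₁ (+-cong (*-congˡ {x = - s + σ * x} h₂) (+-cong h₃ (*-congˡ {x = y} h₃))))
            (identity σ x y g g′ s t t′)
    where
    identity : ∀ σ x y g g′ s t t′ → _
    identity = solve 8 (λ σ x y g g′ s t t′ →
      let u = t′ :+ (:- σ) :* (x :* (g′ :- g))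
          v = (s :+ ((:- σ) :* x :+ (:- σ) :* x)) :* g′
          k = :- s :+ σ :* x
          r = σ :* (x :* g)
      in u :- y :* u :- ((t′ :- y :* t′ :+ (r :+ r)) :+ (k :* (g′ :- y :* g′) :+ (t :+ y :* t)))
      := v :- y :* v :- ((t :+ y :* t) :+ (k :* (g :+ y :* g) :+ (s :* g :+ y :* (s :* g))))) refl

  open Cyclic _+_ _*_ 0#

  private
    _⊛ₚ[_]_ : ∀ {m n} → Vec (Polynomial m) n → Polynomial m → Vec (Polynomial m) 5 → Vec (Polynomial m) 5
    _⊛ₚ[_]_ = Cyclic._⊛[_]_ _:+_ _:*_ (con 0)

  -- A term with i factors b q and j factors c q⁴ lands in degree 0 exactly when 5 divides i + 4 j,
  -- which for at most four factors means i = j. Here b c arises twice.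
  theta² : ∀ t a b c → let φ = a ∷ b ∷ 0# ∷ 0# ∷ c ∷ [] in
    head (φ ⊛[ t ] φ) ≈ a * a + (t * b * c + t * b * c)
  theta² = solve 4 (λ t a b c → let φ = a ∷ b ∷ con 0 ∷ con 0 ∷ c ∷ [] in
    head (φ ⊛ₚ[ t ] φ) := a :* a :+ (t :* b :* c :+ t :* b :* c)) refl

  -- The factors a, b, c can be ordered in 3! = 6 ways, and 6 is 1 modulo 5.
  theta³ : ∀ t a b c → let φ = a ∷ b ∷ 0# ∷ 0# ∷ c ∷ [] in
    head ((φ ⊛[ t ] φ) ⊛[ t ] φ) ≈ a * (a * a + t * b * c)
  theta³ = solve 4 (λ t a b c → let φ = a ∷ b ∷ con 0 ∷ con 0 ∷ c ∷ [] in
    head ((φ ⊛ₚ[ t ] φ) ⊛ₚ[ t ] φ) := a :* (a :* a :+ t :* b :* c)) refl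

  -- The multinomial coefficients 1, 12, 6 of a⁴, a² b c and b² c² are 1, 2, 1 modulo 5, which makes
  -- the sum a perfect square.
  theta⁴ : ∀ t a b c → let φ = a ∷ b ∷ 0# ∷ 0# ∷ c ∷ [] in
    head ((φ ⊛[ t ] φ) ⊛[ t ] (φ ⊛[ t ] φ)) ≈ (a * a + t * b * c) * (a * a + t * b * c)
  theta⁴ = solve 4 (λ t a b c → let φ = a ∷ b ∷ con 0 ∷ con 0 ∷ c ∷ [] in
    head ((φ ⊛ₚ[ t ] φ) ⊛ₚ[ t ] (φ ⊛ₚ[ t ] φ)) := (a :* a :+ t :* b :* c) :* (a :* a :+ t :* b :* c)) refl

  -- 6 is 1 modulo 5, so 3 inverts 2.
  halve : ∀ {x y} → x + x ≈ y + y → x ≈ y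
  halve {x} {y} eq = begin
    x                            ≈⟨ triple x ⟨
    (x + x) + (x + x) + (x + x)  ≈⟨ +-cong (+-cong eq eq) eq ⟩
    (y + y) + (y + y) + (y + y)  ≈⟨ triple y ⟩
    y                            ∎
    where
    triple : ∀ x → (x + x) + (x + x) + (x + x) ≈ x
    triple = solve 1 (λ x → (x :+ x) :+ (x :+ x) :+ (x :+ x) := x) refl

-- Frobenius and products of dissected series

module FiveDissection {r ℓ : Level} (R : CommutativeRing r ℓ)
  (5≈0 : CharacteristicDivides 5 (PowerSeries.commutativeRing R)) where

  open import Data.Nat.Base as ℕ using (ℕ; zero; suc)
  open import Data.Nat.GeneralisedArithmetic using (fold)
  open import Data.Vec.Base using (Vec; []; _∷_; replicate; zipWith; map; head)
  private module R = CommutativeRing R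
  open PowerSeries R public hiding (_≈_; _+_; _*_; -_; 0#; 1#; *-cong; *-zeroˡ; *-identityˡ; *-comm; *-assoc)
  open CommutativeRing (PowerSeries.commutativeRing R) public hiding (zero)
  open import Algebra.Properties.Semiring.Exp semiring public using (_^_; ^-congˡ; ^-homo-*)
  open import Algebra.Properties.CommutativeSemiring.Exp commutativeSemiring public using (^-distrib-*)
  open import Algebra.Properties.CommutativeSemigroup *-commutativeSemigroup using (x∙yz≈y∙xz)
  open import Algebra.Properties.CommutativeSemigroup +-commutativeSemigroup using (interchange)
  open import Algebra.Properties.Semiring.Exp R.semiring using () renaming (_^_ to _^ᴿ_)
  open import Relation.Binary.Reasoning.Setoid setoid
  open Cyclic _+_ _*_ 0#
  open Characteristic5 commutativeRing 5≈0 public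

  const-homo-* : ∀ a b → const (a R.* b) ≈ const a * const b
  const-homo-* a b n = R.sym (R.trans (const-* a (const b) n) (lemma n))
    where
    lemma : ∀ n → a R.* const b n R.≈ const (a R.* b) n
    lemma zero    = R.refl
    lemma (suc n) = R.zeroʳ a

  expansion : ∀ f → f ≈ const (f 0) + q * tail f
  expansion f zero    = R.sym (R.trans (R.+-congˡ (q*≈shift (tail f) 0)) (R.+-identityʳ _))
  expansion f (suc n) = R.sym (R.trans (R.+-congˡ (q*≈shift (tail f) (suc n))) (R.+-identityˡ _))

  q^k*≈shift^k : ∀ k f → q ^ k * f ≈ fold f shift k
  q^k*≈shift^k zero    f = *-identityˡ f
  q^k*≈shift^k (suc k) f = begin
    (q * q ^ k) * f        ≈⟨ *-assoc q (q ^ k) f ⟩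
    q * (q ^ k * f)        ≈⟨ q*≈shift _ ⟩
    shift (q ^ k * f)      ≈⟨ shift-cong (q^k*≈shift^k k f) ⟩
    shift (fold f shift k) ∎

  const-^ : ∀ a n → const (a ^ᴿ n) ≈ const a ^ n
  const-^ a zero = λ { zero → R.refl ; (suc _) → R.refl }
  const-^ a (suc n) = trans (const-homo-* a (a ^ᴿ n)) (*-congˡ (const-^ a n))

  const-cong : ∀ {a b} → a R.≈ b → const a ≈ const b
  const-cong a≈b zero    = a≈b
  const-cong a≈b (suc _) = R.refl

  module _ (fermat : ∀ a → a ^ᴿ 5 R.≈ a) where
    private
      fifth-power : ∀ f → f ^ 5 ≈ const (f 0) + fold (tail f ^ 5) shift 5
      fifth-power f = begin
        f ^ 5                                    ≈⟨ ^-congˡ 5 (expansion f) ⟩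
        (const (f 0) + q * tail f) ^ 5           ≈⟨ frobenius-+ (const (f 0)) (q * tail f) ⟩
        const (f 0) ^ 5 + (q * tail f) ^ 5       ≈⟨ +-cong (const-^ (f 0) 5) (sym (^-distrib-* q (tail f) 5)) ⟨
        const (f 0 ^ᴿ 5) + q ^ 5 * tail f ^ 5    ≈⟨ +-cong (const-cong (fermat (f 0))) (q^k*≈shift^k 5 (tail f ^ 5)) ⟩
        const (f 0) + fold (tail f ^ 5) shift 5  ∎

    -- With f = f₀ + q (tail f), the fifth power is f₀⁵ + q⁵ (tail f)⁵, and f₀⁵ = f₀. Thus
    -- coefficient n + 5 for `f` reduces to coefficient n for `tail f`.
    frobenius : ∀ f → f ^ 5 ≈ V f
    frobenius f n = R.trans (fifth-power f n) (go n)
      where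
      go : ∀ n → (const (f 0) + fold (tail f ^ 5) shift 5) n R.≈ V f n
      go 0 = R.+-identityʳ _
      go 1 = R.+-identityʳ _
      go 2 = R.+-identityʳ _
      go 3 = R.+-identityʳ _
      go 4 = R.+-identityʳ _
      go (suc (suc (suc (suc (suc n))))) = R.trans (R.+-identityˡ _) (frobenius (tail f) n)

  -- Σ qⁱ fᵢ(q⁵)
  D : ∀ {n} → Vec Series n → Series
  D []       = 0#
  D (f ∷ fs) = V f + q * D fs

  D-+ : ∀ {n} (fs gs : Vec Series n) → D (zipWith _+_ fs gs) ≈ D fs + D gs
  D-+ []       []       = sym (+-identityˡ 0#)
  D-+ (f ∷ fs) (g ∷ gs) = begin
    V (f + g) + q * D (zipWith _+_ fs gs)  ≈⟨ +-cong (V-+ f g) (trans (*-congˡ (D-+ fs gs)) (distribˡ q _ _)) ⟩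
    (V f + V g) + (q * D fs + q * D gs)    ≈⟨ interchange _ _ _ _ ⟩
    D (f ∷ fs) + D (g ∷ gs)                ∎

  D-V* : ∀ {n} f (gs : Vec Series n) → D (map (f *_) gs) ≈ V f * D gs
  D-V* f []       = sym (zeroʳ (V f))
  D-V* f (g ∷ gs) = begin
    V (f * g) + q * D (map (f *_) gs)  ≈⟨ +-cong (V-* f g) (trans (*-congˡ (D-V* f gs)) (x∙yz≈y∙xz _ _ _)) ⟩
    V f * V g + V f * (q * D gs)       ≈⟨ distribˡ (V f) _ _ ⟨
    V f * D (g ∷ gs)                   ∎

  V-1 : V 1# ≈ 1#
  V-1 0 = R.refl
  V-1 1 = R.refl
  V-1 2 = R.refl
  V-1 3 = R.refl
  V-1 4 = R.refl
  V-1 (suc (suc (suc (suc (suc n))))) = V-0 n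

  V-q : V q ≈ q ^ 5
  V-q n = R.trans (go n) (R.sym (R.trans (sym (*-identityʳ (q ^ 5)) n) (q^k*≈shift^k 5 1# n)))
    where
    go : V q ≈ fold 1# shift 5
    go 0 = R.refl
    go 1 = R.refl
    go 2 = R.refl
    go 3 = R.refl
    go 4 = R.refl
    go (suc (suc (suc (suc (suc n))))) = V-1 n

  D-0 : ∀ n → D (replicate n 0#) ≈ 0#
  D-0 zero    = refl
  D-0 (suc n) = begin
    V 0# + q * D (replicate n 0#)  ≈⟨ +-cong V-0 (*-congˡ (D-0 n)) ⟩
    0# + q * 0#                    ≈⟨ +-identityˡ _ ⟩
    q * 0#                         ≈⟨ zeroʳ q ⟩
    0#                             ∎

  -- This is why t is q: `V` turns the overflow q g₄ into q⁵ V g₄.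
  D-rotate : ∀ gs → D (rotate q gs) ≈ q * D gs
  D-rotate (g₀ ∷ g₁ ∷ g₂ ∷ g₃ ∷ g₄ ∷ []) = begin
    V (q * g₄) + q * D (g₀ ∷ g₁ ∷ g₂ ∷ g₃ ∷ [])  ≈⟨ +-congʳ (trans (V-* q g₄) (*-congʳ V-q)) ⟩
    q ^ 5 * V g₄ + q * D (g₀ ∷ g₁ ∷ g₂ ∷ g₃ ∷ [])  ≈⟨ horner-rotate q (V g₀) (V g₁) (V g₂) (V g₃) (V g₄) ⟩
    q * D (g₀ ∷ g₁ ∷ g₂ ∷ g₃ ∷ g₄ ∷ [])          ∎

  D-⊛ : ∀ {n} (fs : Vec Series n) gs → D (fs ⊛[ q ] gs) ≈ D fs * D gs
  D-⊛ []       gs = trans (D-0 5) (sym (zeroˡ (D gs)))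
  D-⊛ (f ∷ fs) gs = begin
    D (zipWith _+_ (map (f *_) gs) (fs ⊛[ q ] rotate q gs))  ≈⟨ D-+ (map (f *_) gs) (fs ⊛[ q ] rotate q gs) ⟩
    D (map (f *_) gs) + D (fs ⊛[ q ] rotate q gs)            ≈⟨ +-cong (D-V* f gs) (D-⊛ fs (rotate q gs)) ⟩
    V f * D gs + D fs * D (rotate q gs)                 ≈⟨ +-congˡ (*-congˡ (D-rotate gs)) ⟩
    V f * D gs + D fs * (q * D gs)                    ≈⟨ +-congˡ (*-assoc (D fs) q (D gs)) ⟨
    V f * D gs + D fs * q * D gs                      ≈⟨ +-congˡ (*-congʳ (*-comm (D fs) q)) ⟩
    V f * D gs + q * D fs * D gs                      ≈⟨ distribʳ (D gs) (V f) (q * D fs) ⟨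
    D (f ∷ fs) * D gs                                 ∎

  U-V : ∀ f → U (V f) ≈ f
  U-V f = begin
    U (V f)       ≈⟨ U-cong (*-identityʳ (V f)) ⟨
    U (V f * 1#)  ≈⟨ U-V* f 1# ⟩
    f * U 1#      ≈⟨ *-congˡ (λ { zero → R.refl ; (suc _) → R.refl }) ⟩
    f * 1#        ≈⟨ *-identityʳ f ⟩
    f             ∎

  -- `U` is linear over the image of `V`, and it kills q^k for k from 1 to 4.
  U-D : ∀ (fs : Vec Series 5) → U (D fs) ≈ head fs
  U-D (f₀ ∷ f₁ ∷ f₂ ∷ f₃ ∷ f₄ ∷ []) = begin
    U (D (f₀ ∷ f₁ ∷ f₂ ∷ f₃ ∷ f₄ ∷ []))
      ≈⟨ U-cong (horner-expand q (V f₀) (V f₁) (V f₂) (V f₃) (V f₄)) ⟩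
    U (V f₀) + U (V f₁ * q ^ 1) + U (V f₂ * q ^ 2) + U (V f₃ * q ^ 3) + U (V f₄ * q ^ 4)
      ≈⟨ +-cong (+-cong (+-cong (+-cong (U-V f₀)
           (vanish 1 f₁ λ { zero → R.refl ; (suc _) → R.refl })) (vanish 2 f₂ λ { zero → R.refl ; (suc _) → R.refl }))
           (vanish 3 f₃ λ { zero → R.refl ; (suc _) → R.refl })) (vanish 4 f₄ λ { zero → R.refl ; (suc _) → R.refl }) ⟩
    f₀ + 0# + 0# + 0# + 0#
      ≈⟨ trans (+-identityʳ _) (trans (+-identityʳ _) (trans (+-identityʳ _) (+-identityʳ _))) ⟩
    f₀ ∎
    where
    vanish : ∀ k f → U (fold 1# shift k) ≈ 0# → U (V f * q ^ k) ≈ 0#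
    vanish k f eq = begin
      U (V f * q ^ k)           ≈⟨ U-V* f (q ^ k) ⟩
      f * U (q ^ k)             ≈⟨ *-congˡ (U-cong (*-identityʳ (q ^ k))) ⟨
      f * U (q ^ k * 1#)        ≈⟨ *-congˡ (U-cong (q^k*≈shift^k k 1#)) ⟩
      f * U (fold 1# shift k)   ≈⟨ *-congˡ eq ⟩
      f * 0#                    ≈⟨ zeroʳ f ⟩
      0#                        ∎

  U²-twist : ∀ {a} → a ^ᴿ 5 R.≈ a → ∀ f → U (U (twist a f)) ≈ twist a (U (U f))
  U²-twist a⁵≈a f = trans (U-cong (U-twist a⁵≈a f)) (U-twist a⁵≈a (U f))

  untwist-U⁴ : ∀ {a} → a R.* a R.≈ R.1# → a ^ᴿ 5 R.≈ a → ∀ f →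
               U (U (U (U (twist a f)))) ≈ U (U (twist a f)) → U (U (U (U f))) ≈ U (U f)
  untwist-U⁴ {a} a²≈1 a⁵≈a f eq = begin
    U (U (U (U f)))                      ≈⟨ twist-involutive a²≈1 _ ⟨
    twist a (twist a (U (U (U (U f)))))  ≈⟨ twist-cong a (U²-twist a⁵≈a (U (U f))) ⟨
    twist a (U (U (twist a (U (U f)))))  ≈⟨ twist-cong a (U-cong (U-cong (U²-twist a⁵≈a f))) ⟨
    twist a (U (U (U (U (twist a f)))))  ≈⟨ twist-cong a eq ⟩
    twist a (U (U (twist a f)))          ≈⟨ twist-cong a (U²-twist a⁵≈a f) ⟩
    twist a (twist a (U (U f)))          ≈⟨ twist-involutive a²≈1 _ ⟩
    U (U f)                              ∎

  -- The action of U on the powers of φ and on its inverse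

  module _
    (fermat : ∀ a → a ^ᴿ 5 R.≈ a)
    {φ Q : Series}
    (Q*φ≈1 : Q * φ ≈ 1#)
    (Uφ≈Vφ : U φ ≈ V φ)
    (U-φ² : U (φ * φ) + V (φ * φ) ≈ φ * φ + φ * φ)
    (φ₂≈0 : ∀ n → φ (2 ℕ.+ n ℕ.* 5) R.≈ R.0#)
    (φ₃≈0 : ∀ n → φ (3 ℕ.+ n ℕ.* 5) R.≈ R.0#)
    where

    private
      a b c : Series
      a = U φ
      b = U (tail φ)
      c = U (tail (tail (tail (tail φ))))

      φ⃗ : Vec Series 5
      φ⃗ = a ∷ b ∷ 0# ∷ 0# ∷ c ∷ []

      shift⁴ : ∀ f → shift (shift (shift (shift f))) ≈ q * (q * (q * (q * f)))
      shift⁴ f = sym (trans (q*≈shift _) (shift-cong (trans (q*≈shift _)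
        (shift-cong (trans (q*≈shift _) (shift-cong (q*≈shift f)))))))

      φ≈D : φ ≈ D φ⃗
      φ≈D = begin
        φ
          ≈⟨ dissection φ φ₂≈0 φ₃≈0 ⟩
        V a + (shift (V b) + shift (shift (shift (shift (V c)))))
          ≈⟨ +-congˡ (+-cong (sym (q*≈shift (V b))) (shift⁴ (V c))) ⟩
        V a + (q * V b + q * (q * (q * (q * V c))))
          ≈⟨ horner-sparse q (V a) (V b) (V c) ⟩
        V a + q * (V b + q * (0# + q * (0# + q * (V c + q * 0#))))
          ≈⟨ +-congˡ (*-congˡ (+-congˡ (*-congˡ (+-cong V-0 (*-congˡ (+-congʳ V-0)))))) ⟨
        D φ⃗ ∎

      φ²≈D : φ * φ ≈ D (φ⃗ ⊛[ q ] φ⃗)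
      φ²≈D = trans (*-cong φ≈D φ≈D) (sym (D-⊛ φ⃗ φ⃗))

      U-φ²′ : U (φ * φ) ≈ a * a + (q * b * c + q * b * c)
      U-φ²′ = trans (U-cong φ²≈D) (trans (U-D (φ⃗ ⊛[ q ] φ⃗)) (theta² q a b c))

      -- As a equals both `U φ` and `V φ`, its square is V(φ²). The hypothesis `U-φ²` thus reads 2
      -- a² + 2 q b c = 2 φ².
      φ²≈ : a * a + q * b * c ≈ φ * φ
      φ²≈ = halve (begin
        (a * a + q * b * c) + (a * a + q * b * c)    ≈⟨ regroup (a * a) (q * b * c) ⟩
        (a * a + (q * b * c + q * b * c)) + a * a    ≈⟨ +-cong (sym U-φ²′) (trans (*-cong Uφ≈Vφ Uφ≈Vφ) (sym (V-* φ φ))) ⟩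
        U (φ * φ) + V (φ * φ)                        ≈⟨ U-φ² ⟩
        φ * φ + φ * φ                                ∎)

    U-φ³ : U (φ * φ * φ) ≈ V φ * (φ * φ)
    U-φ³ = begin
      U (φ * φ * φ)              ≈⟨ U-cong (trans (*-cong φ²≈D φ≈D) (sym (D-⊛ (φ⃗ ⊛[ q ] φ⃗) φ⃗))) ⟩
      U (D ((φ⃗ ⊛[ q ] φ⃗) ⊛[ q ] φ⃗))       ≈⟨ trans (U-D ((φ⃗ ⊛[ q ] φ⃗) ⊛[ q ] φ⃗)) (theta³ q a b c) ⟩
      a * (a * a + q * b * c)    ≈⟨ *-cong Uφ≈Vφ φ²≈ ⟩
      V φ * (φ * φ)              ∎

    U-φ⁴ : U (φ * φ * (φ * φ)) ≈ φ * φ * (φ * φ)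
    U-φ⁴ = begin
      U (φ * φ * (φ * φ))                          ≈⟨ U-cong (trans (*-cong φ²≈D φ²≈D) (sym (D-⊛ (φ⃗ ⊛[ q ] φ⃗) (φ⃗ ⊛[ q ] φ⃗)))) ⟩
      U (D ((φ⃗ ⊛[ q ] φ⃗) ⊛[ q ] (φ⃗ ⊛[ q ] φ⃗)))                  ≈⟨ trans (U-D ((φ⃗ ⊛[ q ] φ⃗) ⊛[ q ] (φ⃗ ⊛[ q ] φ⃗))) (theta⁴ q a b c) ⟩
      (a * a + q * b * c) * (a * a + q * b * c)    ≈⟨ *-cong φ²≈ φ²≈ ⟩
      φ * φ * (φ * φ)                              ∎

    U-Q : U Q ≈ φ * φ * φ
    U-Q = begin
      U Q                          ≈⟨ *-identityʳ (U Q) ⟨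
      -- 1 is traded for Q φ: the factor φ passes under `U` as V φ = φ⁵, while the extra Q waits to
      -- divide by φ at the end.
      U Q * 1#                     ≈⟨ *-congˡ Q*φ≈1 ⟨
      U Q * (Q * φ)                ≈⟨ rotate-product (U Q) Q φ ⟩
      φ * U Q * Q                  ≈⟨ *-congʳ (U-V* φ Q) ⟨
      U (V φ * Q) * Q              ≈⟨ *-congʳ (U-cong (*-congʳ (frobenius fermat φ))) ⟨
      U (φ ^ 5 * Q) * Q            ≈⟨ *-congʳ (U-cong (split-power φ Q)) ⟩
      U (φ * φ * (φ * φ) * (Q * φ)) * Q  ≈⟨ *-congʳ (U-cong (trans (*-congˡ Q*φ≈1) (*-identityʳ _))) ⟩
      U (φ * φ * (φ * φ)) * Q      ≈⟨ *-congʳ U-φ⁴ ⟩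
      φ * φ * (φ * φ) * Q          ≈⟨ split-last φ Q ⟩
      φ * φ * φ * (Q * φ)          ≈⟨ trans (*-congˡ Q*φ≈1) (*-identityʳ _) ⟩
      φ * φ * φ                    ∎

    U²-Q : U (U Q) ≈ V φ * (φ * φ)
    U²-Q = trans (U-cong U-Q) U-φ³

    U⁴-Q : U (U (U (U Q))) ≈ U (U Q)
    U⁴-Q = begin
      U (U (U (U Q)))                            ≈⟨ U-cong (U-cong U²-Q) ⟩
      U (U (V φ * (φ * φ)))                      ≈⟨ U-cong (U-V* φ (φ * φ)) ⟩
      U (φ * U (φ * φ))                          ≈⟨ U-cong (isolate φ (U (φ * φ)) (V (φ * φ))) ⟩
      U (φ * (U (φ * φ) + V (φ * φ)) - V (φ * φ) * φ)  ≈⟨ U-cong (+-congʳ {x = - (V (φ * φ) * φ)} (*-congˡ U-φ²)) ⟩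
      U (φ * (φ * φ + φ * φ) - V (φ * φ) * φ)    ≈⟨ U-cong (+-congʳ {x = - (V (φ * φ) * φ)} (double φ)) ⟩
      U (φ * φ * φ) + U (φ * φ * φ) - U (V (φ * φ) * φ)
                                                 ≈⟨ +-cong (+-cong U-φ³ U-φ³) (-‿cong (trans (U-V* (φ * φ) φ) (*-congˡ Uφ≈Vφ))) ⟩
      V φ * (φ * φ) + V φ * (φ * φ) - φ * φ * V φ  ≈⟨ cancel (V φ) (φ * φ) ⟩
      V φ * (φ * φ)                              ≈⟨ U²-Q ⟨
      U (U Q)                                    ∎

-- Gauss's identity by Shanks' finite form

module GaussIdentity {r ℓ : Level} (R : CommutativeRing r ℓ)
  (5≈0 : CharacteristicDivides 5 (PowerSeries.commutativeRing R)) where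

  open import Data.Nat.Base as ℕ using (ℕ; zero; suc)
  import Data.Nat.Properties as ℕ
  open import Data.Nat.GeneralisedArithmetic using (fold)
  import Relation.Binary.PropositionalEquality as ≡
  private module R = CommutativeRing R
  open FiveDissection R 5≈0
  open import Relation.Binary.Reasoning.Setoid setoid
  open import Algebra.Properties.CommutativeSemigroup *-commutativeSemigroup using (x∙yz≈y∙xz)
  open import Algebra.Properties.Group +-group using (x∙y⁻¹≈ε⇒x≈y)
  open import Algebra.Properties.Ring R.ring using (-1*x≈-x; -0#≈0#; -‿involutive)
  open import Algebra.Properties.Semiring.Exp R.semiring using () renaming (_^_ to _^ᴿ_)

  Vanishes : ℕ → Series → Set ℓ
  Vanishes n f = ∀ m → m ℕ.< n → f m R.≈ R.0#

  vanishes-shift : ∀ {n f} k → Vanishes n f → Vanishes (k ℕ.+ n) (fold f shift k)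
  vanishes-shift zero    v m       m<n         = v m m<n
  vanishes-shift (suc k) v zero    m<n         = R.refl
  vanishes-shift (suc k) v (suc m) (ℕ.s≤s m<n) = vanishes-shift k v m m<n

  vanishes-q^ : ∀ k f → Vanishes k (q ^ k * f)
  vanishes-q^ k f m m<k = R.trans (q^k*≈shift^k k f m)
    (vanishes-shift {0} {f} k (λ _ ()) m (≡.subst (m ℕ.<_) (≡.sym (ℕ.+-identityʳ k)) m<k))

  -- Each use of the equation raises the order of vanishing by at least one.
  f≈q*f⇒f≈0 : ∀ n f → f ≈ q ^ suc n * f → f ≈ 0#
  f≈q*f⇒f≈0 n f eq m = vanishes (suc m) m ℕ.≤-refl
    where
    vanishes : ∀ N → Vanishes N f
    vanishes zero    m ()
    vanishes (suc N) m m<1+N = R.trans (eq m) (R.trans (q^k*≈shift^k (suc n) f m)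
      (vanishes-shift (suc n) (vanishes N) m (ℕ.≤-trans m<1+N (ℕ.s≤s (ℕ.m≤n+m N n)))))

  cancel-1-q^ : ∀ n f g → f - q ^ suc n * f ≈ g - q ^ suc n * g → f ≈ g
  cancel-1-q^ n f g eq = x∙y⁻¹≈ε⇒x≈y f g (f≈q*f⇒f≈0 n (f - g) (difference _ f g eq))

  sign : ℕ → Series
  sign zero    = 1#
  sign (suc n) = - sign n

  -- φ(-q) truncated to |x| ≤ n, with the sign written as (-1)ˣ.
  thetaSum : ℕ → Series
  thetaSum zero    = 1#
  thetaSum (suc n) = thetaSum n + (sign (suc n) * q ^ (suc n ℕ.* suc n) + sign (suc n) * q ^ (suc n ℕ.* suc n))

  module _ (G : ℕ → Series) (G₀ : G 0 ≈ 1#)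
    (G-suc : ∀ n → G (suc n) - q ^ suc n * G (suc n) ≈ G n + q ^ suc n * G n) where

    private
      -- Shanks' finite form of Gauss's identity is thetaSum n * G n = T n n, where
      -- T n k = Σ_{s ≤ k} (-1)ˢ q^{sn} (G_s − G_{s−1}).
      T : ℕ → ℕ → Series
      T n zero    = G 0
      T n (suc k) = T n k + sign (suc k) * (q ^ (suc k ℕ.* n) * (G (suc k) - G k))

      q^-suc : ∀ k n → q ^ (k ℕ.* suc n) ≈ q ^ k * q ^ (k ℕ.* n)
      q^-suc k n = trans (reflexive (≡.cong (q ^_) (ℕ.*-suc k n))) (^-homo-* q k (k ℕ.* n))

      -- The difference of (1 + y) T(n, k) and (1 - y) T(n+1, k) collapses to the boundary term 2 x:
      -- the summands added at k + 1 change it exactly as `x` changes.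
      telescope : ∀ n k → let y = q ^ suc n; x = sign k * (q ^ (suc k ℕ.* suc n) * G k) in
        T (suc n) k - y * T (suc n) k + (x + x) ≈ T n k + y * T n k
      telescope n zero = trans (+-congˡ (+-cong simplify simplify)) (telescope-base (q ^ suc n) (G 0))
        where
        simplify : 1# * (q ^ (suc n ℕ.+ 0) * G 0) ≈ q ^ suc n * G 0
        simplify = trans (*-identityˡ _) (*-congʳ (reflexive (≡.cong (q ^_) (ℕ.+-identityʳ (suc n)))))
      telescope n (suc k) = begin
        T′ - y * T′ + (x + x)
          ≈⟨ +-cong (+-cong T′≈ (-‿cong (*-congˡ T′≈))) (+-cong x≈ x≈) ⟩
        _
          ≈⟨ telescope-step (trans (+-congˡ (+-cong IH≈ IH≈)) (telescope n k)) (G-suc k) ⟩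
        T n (suc k) + y * T n (suc k) ∎
        where
        y = q ^ suc n
        z = q ^ (suc k ℕ.* n)
        w = q ^ suc k
        T′ = T (suc n) (suc k)
        x = sign (suc k) * (q ^ (suc (suc k) ℕ.* suc n) * G (suc k))
        T′≈ : T′ ≈ T (suc n) k + - sign k * ((w * z) * (G (suc k) - G k))
        T′≈ = +-congˡ (*-congˡ (*-congʳ (q^-suc (suc k) n)))
        x≈ : x ≈ - sign k * ((y * (w * z)) * G (suc k))
        x≈ = *-congˡ (*-congʳ (trans (^-homo-* q (suc n) (suc k ℕ.* suc n)) (*-congˡ (q^-suc (suc k) n))))
        IH≈ : sign k * ((w * z) * G k) ≈ sign k * (q ^ (suc k ℕ.* suc n) * G k)
        IH≈ = *-congˡ (*-congʳ (sym (q^-suc (suc k) n)))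

    -- At k = n the boundary term of `telescope` has exponent (n + 1)², the new exponent of
    -- `thetaSum`.
    finite-gauss : ∀ n → T n n ≈ thetaSum n * G n
    finite-gauss zero    = sym (*-identityˡ (G 0))
    finite-gauss (suc n) = cancel-1-q^ n _ _ (gauss-step (telescope n n) (G-suc n) (finite-gauss n))

    -- Every summand of `T n n` with s ≥ 1 carries q^(s n), so modulo q^n only G₀ = 1 is left.
    thetaSum*G : ∀ n m → m ℕ.< n → (thetaSum n * G n) m R.≈ 1# m
    thetaSum*G n m m<n = R.trans (sym (finite-gauss n) m) (T-m n)
      where
      T-m : ∀ k → T n k m R.≈ 1# m
      T-m zero    = G₀ m
      T-m (suc k) = R.trans (R.+-cong (T-m k) (R.trans (x∙yz≈y∙xz _ _ _ m)
        (vanishes-q^ (suc k ℕ.* n) _ m (ℕ.≤-trans m<n (ℕ.m≤m+n n (k ℕ.* n)))))) (R.+-identityʳ _)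

  private
    -1² : R.- R.1# R.* R.- R.1# R.≈ R.1#
    -1² = R.trans (-1*x≈-x (R.- R.1#)) (-‿involutive R.1#)

  sign≈ : ∀ n → sign n ≈ const ((R.- R.1#) ^ᴿ n)
  sign≈ zero    zero    = R.refl
  sign≈ zero    (suc m) = R.refl
  sign≈ (suc n) zero    = R.trans (R.-‿cong (sign≈ n zero)) (R.sym (-1*x≈-x _))
  sign≈ (suc n) (suc m) = R.trans (R.-‿cong (sign≈ n (suc m))) -0#≈0#

  -- x and x² have the same parity, so the sign (-1)ˣ at q^(x²) is the effect of replacing q by -q.
  thetaSum≈twist : ∀ N → thetaSum N ≈ twist (R.- R.1#) (truncatedTheta N)
  thetaSum≈twist zero    = sym (twist-1 _)
  thetaSum≈twist (suc N) = begin
    thetaSum N + (sign k * q ^ (k ℕ.* k) + sign k * q ^ (k ℕ.* k))  ≈⟨ +-cong (thetaSum≈twist N) (+-cong δ≈ δ≈) ⟩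
    twist -1# (truncatedTheta N) + (twist -1# δ + twist -1# δ)      ≈⟨ +-congˡ (twist-+ -1# δ δ) ⟨
    twist -1# (truncatedTheta N) + twist -1# (δ + δ)                ≈⟨ twist-+ -1# (truncatedTheta N) (δ + δ) ⟨
    twist -1# (truncatedTheta N + (δ + δ))                          ∎
    where
    -1# = R.- R.1#
    k = suc N
    δ = fold 1# shift (k ℕ.* k)
    δ≈ : sign k * q ^ (k ℕ.* k) ≈ twist -1# δ
    δ≈ = begin
      sign k * q ^ (k ℕ.* k)           ≈⟨ *-cong (sign≈ k) (trans (sym (*-identityʳ _)) (q^k*≈shift^k (k ℕ.* k) 1#)) ⟩
      const (-1# ^ᴿ k) * δ             ≈⟨ const-* (-1# ^ᴿ k) δ ⟩
      -1# ^ᴿ k ∙ δ                     ≈⟨ (λ n → R.*-congʳ (R.sym (a^[n*n]≈a^n -1² k))) ⟩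
      -1# ^ᴿ (k ℕ.* k) ∙ δ             ≈⟨ twist-fold-shift -1# (k ℕ.* k) ⟨
      twist -1# δ                      ∎

  module _ {G H : ℕ → Series} {P θ : Series} (G₀ : G 0 ≈ 1#)
    (G-suc : ∀ n → G (suc n) ≈ G n + (fold (H n) shift (suc n) + fold (H n) shift (suc n)))
    (H-suc : ∀ n → H n ≈ G n + fold (H n) shift (suc n))
    (G-limit : ∀ {n m} → m ℕ.≤ n → G n m R.≈ P m)
    (θ-limit : ∀ {n m} → m ℕ.≤ n → truncatedTheta n m R.≈ θ m)
    where

    private
      -- Eliminating `H n` leaves the factor (1 + q^(n+1)) / (1 - q^(n+1)) of the product for
      -- overpartitions.
      G-quotient : ∀ n → G (suc n) - q ^ suc n * G (suc n) ≈ G n + q ^ suc n * G n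
      G-quotient n = largest-part (trans (G-suc n) (+-congˡ (+-cong shift≈ shift≈))) (trans (H-suc n) (+-congˡ shift≈))
        where
        shift≈ : fold (H n) shift (suc n) ≈ q ^ suc n * H n
        shift≈ = sym (q^k*≈shift^k (suc n) (H n))

    gauss : twist (R.- R.1#) P * θ ≈ 1#
    gauss = begin
      twist -1# P * θ                          ≈⟨ *-congˡ (twist-involutive -1² θ) ⟨
      twist -1# P * twist -1# (twist -1# θ)    ≈⟨ twist-* -1# P (twist -1# θ) ⟨
      twist -1# (P * twist -1# θ)              ≈⟨ twist-cong -1# untwisted ⟩
      twist -1# 1#                             ≈⟨ twist-1 -1# ⟩
      1#                                       ∎
      where
      -1# = R.- R.1#
      untwisted : P * twist -1# θ ≈ 1#
      untwisted m = R.trans (*-comm P (twist -1# θ) m) (R.trans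
        -- Truncation at `suc m` is the least for which `thetaSum*G` reaches coefficient m.
        (*-cong-≤ m
          (λ j j≤m → R.sym (R.trans (thetaSum≈twist (suc m) j) (R.*-congˡ (θ-limit (ℕ.m≤n⇒m≤1+n j≤m)))))
          (λ j j≤m → R.sym (G-limit (ℕ.m≤n⇒m≤1+n j≤m))))
        (thetaSum*G G G₀ G-quotient (suc m) m ℕ.≤-refl))

-- Residue rings carried by the natural numbers

module ResidueRing where

  open import Data.Nat.Base
  open import Data.Nat.Properties
  open import Data.Nat.DivMod
  open import Data.Product.Base using (_,_)
  open import Relation.Binary.PropositionalEquality

  -- ℤ/d with carrier ℕ, so that counting functions are series over it as they stand.
  ℤ/suc_ : ℕ → CommutativeRing 0ℓ 0ℓ
  ℤ/suc n = record
    { Carrier = ℕ ; _≈_ = λ x y → x % d ≡ y % d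
    ; _+_ = _+_ ; _*_ = _*_ ; -_ = n *_ ; 0# = 0 ; 1# = 1
    ; isCommutativeRing = record
      { isRing = record
        { +-isAbelianGroup = record
          { isGroup = record
            { isMonoid = record
              { isSemigroup = record
                { isMagma = record
                  { isEquivalence = record { refl = refl ; sym = sym ; trans = trans }
                  ; ∙-cong = λ {x} {y} {u} {v} → +-mod {x} {y} {u} {v} }
                ; assoc = λ x y z → cong (_% d) (+-assoc x y z) }
              ; identity = (λ _ → refl) , λ x → cong (_% d) (+-identityʳ x) }
            ; inverse = (λ x → trans (cong (_% d) (+-comm (n * x) x)) (negate x)) , negate
            ; ⁻¹-cong = λ {x} {y} → *-mod {n} {n} {x} {y} refl }
          ; comm = λ x y → cong (_% d) (+-comm x y) }
        ; *-cong = λ {x} {y} {u} {v} → *-mod {x} {y} {u} {v}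
        ; *-assoc = λ x y z → cong (_% d) (*-assoc x y z)
        ; *-identity = (λ x → cong (_% d) (*-identityˡ x)) , λ x → cong (_% d) (*-identityʳ x)
        ; distrib = (λ x y z → cong (_% d) (*-distribˡ-+ x y z)) , λ x y z → cong (_% d) (*-distribʳ-+ x y z) }
      ; *-comm = λ x y → cong (_% d) (*-comm x y) } }
    where
    d = suc n
    negate : ∀ x → d * x % d ≡ 0 % d
    negate x = trans (cong (_% d) (*-comm d x)) (m*n%n≡0 x d)
    +-mod : ∀ {x y u v} → x % d ≡ y % d → u % d ≡ v % d → (x + u) % d ≡ (y + v) % d
    +-mod {x} {y} {u} {v} p r = trans (%-distribˡ-+ x u d)
      (trans (cong₂ (λ a b → (a + b) % d) p r) (sym (%-distribˡ-+ y v d)))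
    *-mod : ∀ {x y u v} → x % d ≡ y % d → u % d ≡ v % d → (x * u) % d ≡ (y * v) % d
    *-mod {x} {y} {u} {v} p r = trans (%-distribˡ-* x u d)
      (trans (cong₂ (λ a b → (a * b) % d) p r) (sym (%-distribˡ-* y v d)))

open ResidueRing

-- Overpartitions sorted by their largest part

module OverpartitionCounts where

  open import Data.Bool.Base using (true; false)
  open import Data.List.Base using (List; []; _∷_)
  open import Data.List.Relation.Unary.All using ([]; _∷_)
  open import Data.List.Relation.Unary.AllPairs using ([]; _∷_)
  open import Data.List.Relation.Unary.Any using (here)
  open import Data.List.Relation.Unary.Linked using ([]; [-]; _∷_)
  open import Data.Nat.Base
  open import Data.Nat.Properties
  open import Data.Nat.GeneralisedArithmetic using (fold)
  open import Data.Product.Base using (∃; _×_; _,_; proj₁; proj₂)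
  open import Data.Sum.Base using (_⊎_; inj₁; inj₂)
  open import Data.Unit.Base using (⊤; tt)
  open import Relation.Binary.PropositionalEquality
  open import Relation.Nullary using (¬_; yes; no; contradiction)
  open import Relation.Unary using (Decidable)
  open import Defs
  open Counting
  open PowerSeries (ℤ/suc 4) using (shift)

  counts-overpartitions : ∀ n → Counts (IsOverpartition n) (p̄ n)
  counts-overpartitions n = record
    { elements = overpartitions n ; unique = overpartitions-unique n ; sound = overpartitions-sound
    ; complete = overpartitions-complete ; length≡ = refl }

  Head : (Part → Set) → List Part → Set
  Head P []      = ⊤
  Head P (p ∷ _) = P p

  head? : ∀ {P} → Decidable P → Decidable (Head P)
  head? P? []      = yes tt
  head? P? (p ∷ _) = P? p

  -- Parts are non-increasing, so a bound on the first one bounds them all.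
  Bounded : ℕ → ℕ → List Part → Set
  Bounded n m ps = IsOverpartition m ps × Head (λ p → size p ≤ n) ps

  -- The overpartitions that may follow a part of size n.
  Follows : ℕ → ℕ → List Part → Set
  Follows n m ps = IsOverpartition m ps × Head (mkPart n false ≽_) ps

  LargestPart : Part → ℕ → List Part → Set
  LargestPart p m ps = IsOverpartition m ps × ∃ λ ps′ → ps ≡ p ∷ ps′

  bounded : ∀ n m → ∃ (Counts (Bounded n m))
  bounded n m = counts-filter (head? (λ p → size p ≤? n)) (counts-overpartitions m)

  follows : ∀ n m → ∃ (Counts (Follows n m))
  follows n m = counts-filter (head? (mkPart n false ≽?_)) (counts-overpartitions m)

  #bounded #follows : ℕ → ℕ → ℕ
  #bounded n m = proj₁ (bounded n m)
  #follows n m = proj₁ (follows n m)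

  fold-shift-+ : ∀ (f : ℕ → ℕ) k m → fold f shift k (k + m) ≡ f m
  fold-shift-+ f zero    m = refl
  fold-shift-+ f (suc k) m = fold-shift-+ f k m

  fold-shift-< : ∀ (f : ℕ → ℕ) {k m} → m < k → fold f shift k m ≡ 0
  fold-shift-< f {suc k} {zero}  _         = refl
  fold-shift-< f {suc k} {suc m} (s≤s m<k) = fold-shift-< f m<k

  private
    ∷-overpartition : ∀ {n m b ps} → Follows (suc n) m ps →
                      IsOverpartition (suc n + m) (mkPart (suc n) b ∷ ps)
    ∷-overpartition {n} {ps = []}     ((_ , _ , s) , _) = z<s ∷ [] , [-] , cong (suc n +_) s
    -- `h` speaks of a part that is not overlined but serves for either `b`, because `_≽_` reads
    -- only the size of its left argument.
    ∷-overpartition {n} {ps = p ∷ ps} ((a , l , s) , h) = z<s ∷ a , h ∷ l , cong (suc n +_) s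

    ∷-overpartition⁻ : ∀ {n m b ps} → IsOverpartition (suc n + m) (mkPart (suc n) b ∷ ps) →
                       Follows (suc n) m ps
    ∷-overpartition⁻ {n} {ps = []}     (_ ∷ a , _     , s) = (a , [] , +-cancelˡ-≡ (suc n) _ _ s) , tt
    ∷-overpartition⁻ {n} {ps = p ∷ ps} (_ ∷ a , h ∷ l , s) = (a , l  , +-cancelˡ-≡ (suc n) _ _ s) , h

  -- Removing the first part leaves a list that may follow it, with total smaller by n + 1; the
  -- iterated `shift` is multiplication by q^(n+1).
  counts-largestPart : ∀ n b m → Counts (LargestPart (mkPart (suc n) b) m) (fold (#follows (suc n)) shift (suc n) m)
  counts-largestPart n b m with m <? suc n
  ... | yes m<n = subst (Counts _) (sym (fold-shift-< _ m<n)) (counts-∅ λ where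
          ((_ , _ , s) , _ , refl) → <⇒≱ m<n (subst (suc n ≤_) s (m≤m+n (suc n) _)))
  ... | no m≮n  = subst (λ m → Counts (LargestPart (mkPart (suc n) b) m) (fold (#follows (suc n)) shift (suc n) m))
          (m+[n∸m]≡n (≮⇒≥ m≮n))
          (subst (Counts _) (sym (fold-shift-+ _ (suc n) k))
            (counts-image (mkPart (suc n) b ∷_) (λ { refl → refl })
              (λ f → ∷-overpartition f , _ , refl)
              (λ { (o , ps , refl) → ps , ∷-overpartition⁻ o , refl })
              (proj₂ (follows (suc n) k))))
    where k = m ∸ suc n

  -- A part that repeats the size before it cannot be overlined, so the term for a leading part of
  -- size n + 1 occurs once here and twice in `#bounded-suc`.
  #follows-suc : ∀ n m → #follows (suc n) m ≡ #bounded n m + fold (#follows (suc n)) shift (suc n) m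
  #follows-suc n m = counts-unique (proj₂ (follows (suc n) m))
    (counts-⇔ to from (counts-⊎ disjoint (proj₂ (bounded n m)) (counts-largestPart n false m)))
    where
    disjoint : ∀ {ps} → Bounded n m ps → ¬ LargestPart (mkPart (suc n) false) m ps
    disjoint (_ , h) (_ , _ , refl) = <-irrefl refl h
    to : ∀ {ps} → Bounded n m ps ⊎ LargestPart (mkPart (suc n) false) m ps → Follows (suc n) m ps
    to {[]}    (inj₁ (o , _))     = o , tt
    to {_ ∷ _} (inj₁ (o , h))     = o , inj₁ (s≤s h)
    to (inj₂ (o , _ , refl))      = o , inj₂ (refl , refl)
    from : ∀ {ps} → Follows (suc n) m ps → Bounded n m ps ⊎ LargestPart (mkPart (suc n) false) m ps
    from {[]}    (o , _)                    = inj₁ (o , tt)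
    from {_ ∷ _} (o , inj₁ (s≤s h))         = inj₁ (o , h)
    from {_ ∷ _} (o , inj₂ (refl , refl))   = inj₂ (o , _ , refl)

  #bounded-suc : ∀ n m → let x = fold (#follows (suc n)) shift (suc n) m in
    #bounded (suc n) m ≡ #bounded n m + (x + x)
  #bounded-suc n m = counts-unique (proj₂ (bounded (suc n) m))
    (counts-⇔ to from (counts-⊎ disjoint (proj₂ (bounded n m))
      (counts-⊎ (λ { (_ , _ , refl) (_ , _ , ()) }) (counts-largestPart n false m) (counts-largestPart n true m))))
    where
    Largest : List Part → Set
    Largest ps = LargestPart (mkPart (suc n) false) m ps ⊎ LargestPart (mkPart (suc n) true) m ps
    disjoint : ∀ {ps} → Bounded n m ps → ¬ Largest ps
    disjoint (_ , h) (inj₁ (_ , _ , refl)) = <-irrefl refl h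
    disjoint (_ , h) (inj₂ (_ , _ , refl)) = <-irrefl refl h
    to : ∀ {ps} → Bounded n m ps ⊎ Largest ps → Bounded (suc n) m ps
    to {[]}    (inj₁ (o , _))         = o , tt
    to {_ ∷ _} (inj₁ (o , h))         = o , m≤n⇒m≤1+n h
    to (inj₂ (inj₁ (o , _ , refl)))   = o , ≤-refl
    to (inj₂ (inj₂ (o , _ , refl)))   = o , ≤-refl
    from : ∀ {ps} → Bounded (suc n) m ps → Bounded n m ps ⊎ Largest ps
    from {[]} (o , _) = inj₁ (o , tt)
    from {mkPart s b ∷ _} (o , h) with m≤n⇒m<n∨m≡n h
    ... | inj₁ (s≤s s≤n) = inj₁ (o , s≤n)
    from {mkPart _ false ∷ _} (o , _) | inj₂ refl = inj₂ (inj₁ (o , _ , refl))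
    from {mkPart _ true  ∷ _} (o , _) | inj₂ refl = inj₂ (inj₂ (o , _ , refl))

  bounded-0-[] : ∀ {m ps} → Bounded 0 m ps → ps ≡ [] × m ≡ 0
  bounded-0-[] {ps = []}    ((_ , _ , s) , _)      = refl , sym s
  bounded-0-[] {ps = _ ∷ _} ((0<s ∷ _ , _) , s≤0) = contradiction (≤-trans 0<s s≤0) λ ()

  #bounded-0-0 : #bounded 0 0 ≡ 1
  #bounded-0-0 = counts-unique (proj₂ (bounded 0 0)) (record
    { elements = [] ∷ [] ; unique = [] ∷ []
    ; sound = λ { (here refl) → ([] , [] , refl) , tt }
    ; complete = λ b → here (proj₁ (bounded-0-[] b)) ; length≡ = refl })

  #bounded-0-suc : ∀ m → #bounded 0 (suc m) ≡ 0
  #bounded-0-suc m = counts-unique (proj₂ (bounded 0 (suc m)))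
    (counts-∅ λ b → contradiction (proj₂ (bounded-0-[] b)) λ ())

  #bounded-p̄ : ∀ {n m} → m ≤ n → #bounded n m ≡ p̄ m
  #bounded-p̄ {n} {m} m≤n = counts-unique (proj₂ (bounded n m))
    (counts-⇔ (λ o → o , small o) proj₁ (counts-overpartitions m))
    where
    small : ∀ {ps} → IsOverpartition m ps → Head (λ p → size p ≤ n) ps
    small {[]}    _                 = tt
    small {_ ∷ _} (_ , _ , refl)    = ≤-trans (m≤m+n _ _) m≤n

-- Sums of one and two squares

module LatticePoints where

  open import Data.Integer.Base as ℤ using (ℤ; +_; -[1+_]; ∣_∣)
  import Data.Integer.Properties as ℤ
  open import Data.Integer.Divisibility.Signed as ℤ∣ using (divides; ∣ᵤ⇒∣; ∣⇒∣ᵤ)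
  open import Data.Integer.Tactic.RingSolver using (solve-∀)
  open import Data.List.Base using ([]; _∷_)
  open import Data.List.Relation.Unary.All using ([]; _∷_)
  open import Data.List.Relation.Unary.AllPairs using ([]; _∷_)
  open import Data.List.Relation.Unary.Any using (here)
  open import Data.Nat.Base
  open import Data.Nat.Properties
  import Data.Nat.Divisibility as ℕ∣
  open import Data.Nat.DivMod using (%-distribˡ-*; m%n<n; [m+kn]%n≡m%n)
  open import Data.Nat.GeneralisedArithmetic using (fold)
  open import Data.Nat.Primality using (Prime; prime?; euclidsLemma)
  import Data.Nat.Tactic.RingSolver as ℕ-Solver
  open import Data.Product.Base using (∃; ∃₂; _×_; _,_; proj₁; proj₂)
  open import Data.Product.Properties using (,-injective)
  open import Data.Sum.Base as Sum using (_⊎_; inj₁; inj₂; [_,_]′)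
  open import Relation.Binary.PropositionalEquality
  open import Relation.Nullary using (yes; no)
  open import Relation.Nullary.Decidable using (toWitness)
  open Counting
  open OverpartitionCounts using (fold-shift-+; fold-shift-<)

  open PowerSeries (ℤ/suc 4) using (shift; V; 1#; truncatedTheta) renaming (_*_ to _⊗_)

  -- The recursion of the product separates i = 0 from i > 0. The two cases are disjoint because
  -- `P-unique` gives each point `x` a single weight.
  counts-⊗ : ∀ {A B : Set} {f g : ℕ → ℕ} {P : ℕ → A → Set} {Q : ℕ → B → Set} →
    (∀ {i j x} → P i x → P j x → i ≡ j) →
    (∀ n → Counts (P n) (f n)) → (∀ n → Counts (Q n) (g n)) →
    ∀ n → Counts {A × B} (λ (x , y) → ∃₂ λ i j → i + j ≡ n × P i x × Q j y) ((f ⊗ g) n)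
  counts-⊗ P-unique p q zero = counts-⇔
    (λ (px , qy) → 0 , 0 , refl , px , qy) (λ { (zero , zero , refl , px , qy) → px , qy }) (counts-× (p 0) (q 0))
  counts-⊗ P-unique p q (suc n) = counts-⇔
    (λ { (inj₁ (px , qy)) → 0 , suc n , refl , px , qy ; (inj₂ (i , j , eq , px , qy)) → suc i , j , cong suc eq , px , qy })
    (λ { (zero , _ , refl , px , qy) → inj₁ (px , qy) ; (suc i , j , eq , px , qy) → inj₂ (i , j , suc-injective eq , px , qy) })
    (counts-⊎ (λ { (px , _) (_ , _ , _ , px′ , _) → 0≢1+n (P-unique px px′) })
      (counts-× (p 0) (q (suc n)))
      (counts-⊗ (λ px px′ → suc-injective (P-unique px px′)) (λ m → p (suc m)) q n))

  counts-V : ∀ {A : Set} {f : ℕ → ℕ} {P : ℕ → A → Set} → (∀ n → Counts (P n) (f n)) →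
             ∀ n → Counts (λ x → ∃ λ m → n ≡ m * 5 × P m x) (V f n)
  counts-V p 0 = counts-⇔ (λ px → 0 , refl , px) (λ { (zero , refl , px) → px }) (p 0)
  counts-V p 1 = counts-∅ λ { (zero , () , _) ; (suc _ , () , _) }
  counts-V p 2 = counts-∅ λ { (zero , () , _) ; (suc _ , () , _) }
  counts-V p 3 = counts-∅ λ { (zero , () , _) ; (suc _ , () , _) }
  counts-V p 4 = counts-∅ λ { (zero , () , _) ; (suc _ , () , _) }
  counts-V p (suc (suc (suc (suc (suc n))))) = counts-⇔
    (λ (m , eq , px) → suc m , cong (λ k → 5 + k) eq , px)
    (λ { (suc m , eq , px) → m , +-cancelˡ-≡ 5 _ _ eq , px })
    (counts-V (λ m → p (suc m)) n)

  square : ℤ → ℕ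
  square x = ∣ x ∣ * ∣ x ∣

  counts-singleton : ∀ {A : Set} (x : A) k m → Counts (λ y → y ≡ x × k ≡ m) (fold 1# shift k m)
  counts-singleton x k m with m <? k
  ... | yes m<k = subst (Counts _) (sym (fold-shift-< 1# m<k)) (counts-∅ λ (_ , k≡m) → <-irrefl (sym k≡m) m<k)
  ... | no m≮k  = subst (λ m → Counts (λ y → y ≡ x × k ≡ m) (fold 1# shift k m)) (m+[n∸m]≡n (≮⇒≥ m≮k))
                    (subst (Counts _) (sym (fold-shift-+ 1# k (m ∸ k))) (go (m ∸ k)))
    where
    go : ∀ d → Counts (λ y → y ≡ x × k ≡ k + d) (1# d)
    go zero    = record { elements = x ∷ [] ; unique = [] ∷ [] ; sound = λ { (here refl) → refl , sym (+-identityʳ k) }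
                        ; complete = λ { (refl , _) → here refl } ; length≡ = refl }
    go (suc d) = counts-∅ λ (_ , eq) → m≢1+m+n k (trans eq (+-suc k d))

  counts-truncatedTheta : ∀ N m → Counts (λ x → ∣ x ∣ ≤ N × square x ≡ m) (truncatedTheta N m)
  counts-truncatedTheta zero m = counts-⇔ (λ { (refl , eq) → ≤-refl , eq })
    (λ { {+ zero} (_ , eq) → refl , eq ; {+ suc _} (() , _) ; { -[1+ _ ]} (() , _) })
    (counts-singleton (+ 0) 0 m)
  counts-truncatedTheta (suc N) m = counts-⇔
    (λ { (inj₁ (x≤N , eq)) → m≤n⇒m≤1+n x≤N , eq ; (inj₂ (inj₁ (refl , eq))) → ≤-refl , eq
       ; (inj₂ (inj₂ (refl , eq))) → ≤-refl , eq })
    (λ {x} (x≤1+N , eq) → split x eq (m≤n⇒m<n∨m≡n x≤1+N))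
    (counts-⊎ (λ { (x≤N , _) (inj₁ (refl , _)) → 1+n≰n x≤N ; (x≤N , _) (inj₂ (refl , _)) → 1+n≰n x≤N })
      (counts-truncatedTheta N m)
      (counts-⊎ (λ { (refl , _) (() , _) }) (counts-singleton (+ suc N) k m) (counts-singleton -[1+ N ] k m)))
    where
    k = suc N * suc N
    split : ∀ x → square x ≡ m → ∣ x ∣ < suc N ⊎ ∣ x ∣ ≡ suc N →
            (∣ x ∣ ≤ N × square x ≡ m) ⊎ (x ≡ + suc N × k ≡ m) ⊎ (x ≡ -[1+ N ] × k ≡ m)
    split x          eq (inj₁ (s≤s x≤N)) = inj₁ (x≤N , eq)
    split (+ _)      eq (inj₂ refl)      = inj₂ (inj₁ (refl , eq))
    split (-[1+ _ ]) eq (inj₂ refl)      = inj₂ (inj₂ (refl , eq))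

  -- Truncation at m loses nothing in degree m, since |x| ≤ x².
  theta : ℕ → ℕ
  theta m = truncatedTheta m m

  private
    ∣x∣≤square : ∀ x → ∣ x ∣ ≤ square x
    ∣x∣≤square (+ zero)   = z≤n
    ∣x∣≤square (+ suc n)  = m≤m*n (suc n) (suc n)
    ∣x∣≤square (-[1+ n ]) = m≤m*n (suc n) (suc n)

  counts-square : ∀ {N m} → m ≤ N → Counts (λ x → square x ≡ m) (truncatedTheta N m)
  counts-square {N} {m} m≤N = counts-⇔ proj₂
    (λ {x} eq → ≤-trans (∣x∣≤square x) (≤-trans (≤-reflexive eq) m≤N) , eq) (counts-truncatedTheta N m)

  truncatedTheta-theta : ∀ {N m} → m ≤ N → truncatedTheta N m ≡ theta m
  truncatedTheta-theta m≤N = counts-unique (counts-square m≤N) (counts-square ≤-refl)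

  counts-theta : ∀ m → Counts (λ x → square x ≡ m) (theta m)
  counts-theta m = counts-square ≤-refl

  norm : ℤ × ℤ → ℕ
  norm (x , y) = square x + square y

  counts-theta² : ∀ n → Counts (λ z → norm z ≡ n) ((theta ⊗ theta) n)
  counts-theta² n = counts-⇔ (λ { (_ , _ , eq , refl , refl) → eq }) (λ eq → _ , _ , eq , refl , refl)
    (counts-⊗ (λ p q → trans (sym p) q) counts-theta counts-theta n)

  normℤ : ℤ × ℤ → ℤ
  normℤ (x , y) = x ℤ.* x ℤ.+ y ℤ.* y

  +square : ∀ x → + square x ≡ x ℤ.* x
  +square (+ n)      = ℤ.pos-* n n
  +square (-[1+ n ]) = refl

  +norm : ∀ z → + norm z ≡ normℤ z
  +norm (x , y) = trans (ℤ.pos-+ (square x) (square y)) (cong₂ ℤ._+_ (+square x) (+square y))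

  norm-via-ℤ : ∀ {z w k} → normℤ z ≡ normℤ w ℤ.* + k → norm z ≡ norm w * k
  norm-via-ℤ {z} {w} {k} eq = ℤ.+-injective (begin
    + norm z            ≡⟨ +norm z ⟩
    normℤ z             ≡⟨ eq ⟩
    normℤ w ℤ.* + k     ≡⟨ cong (ℤ._* + k) (+norm w) ⟨
    + norm w ℤ.* + k    ≡⟨ ℤ.pos-* (norm w) k ⟨
    + (norm w * k)      ∎)
    where open ≡-Reasoning

  5-prime : Prime 5
  5-prime = toWitness {a? = prime? 5} _

  infix 4 5∣_
  5∣_ : ℤ → Set
  5∣ x = + 5 ℤ∣.∣ x

  5∣*⇒ : ∀ x y → 5∣ x ℤ.* y → 5∣ x ⊎ 5∣ y
  5∣*⇒ x y 5∣xy = Sum.map ∣ᵤ⇒∣ ∣ᵤ⇒∣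
    (euclidsLemma ∣ x ∣ ∣ y ∣ 5-prime (subst (5 ℕ∣.∣_) (ℤ.abs-* x y) (∣⇒∣ᵤ 5∣xy)))

  -- u + iv ↦ the conjugate of (2 − i)(u + iv)
  spin : ℤ × ℤ → ℤ × ℤ
  spin (u , v) = + 2 ℤ.* u ℤ.+ v , u ℤ.- + 2 ℤ.* v

  normℤ-spin : ∀ u v → let x = + 2 ℤ.* u ℤ.+ v; y = u ℤ.- + 2 ℤ.* v in
    x ℤ.* x ℤ.+ y ℤ.* y ≡ (u ℤ.* u ℤ.+ v ℤ.* v) ℤ.* + 5
  normℤ-spin = solve-∀

  normℤ-5 : ∀ x y → (x ℤ.* + 5) ℤ.* (x ℤ.* + 5) ℤ.+ (y ℤ.* + 5) ℤ.* (y ℤ.* + 5) ≡ (x ℤ.* x ℤ.+ y ℤ.* y) ℤ.* + 25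
  normℤ-5 = solve-∀

  -- Modulo 5 the norm x² + y² is x² - 4 y², which factors over the integers.
  normℤ-factor : ∀ x y → (x ℤ.- + 2 ℤ.* y) ℤ.* (x ℤ.+ + 2 ℤ.* y) ≡ x ℤ.* x ℤ.+ y ℤ.* y ℤ.- y ℤ.* y ℤ.* + 5
  normℤ-factor = solve-∀

  5*proj₁ : ∀ u v → u ℤ.* + 5 ≡ + 2 ℤ.* (+ 2 ℤ.* u ℤ.+ v) ℤ.+ (u ℤ.- + 2 ℤ.* v)
  5*proj₁ = solve-∀

  5*proj₂ : ∀ u v → (+ 2 ℤ.* u ℤ.+ v) ℤ.- + 2 ℤ.* (u ℤ.- + 2 ℤ.* v) ≡ v ℤ.* + 5
  5*proj₂ = solve-∀

  unspin₁ : ∀ y v → + 2 ℤ.* (y ℤ.+ + 2 ℤ.* v) ℤ.+ v ≡ + 2 ℤ.* y ℤ.+ v ℤ.* + 5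
  unspin₁ = solve-∀

  unspin₂ : ∀ y v → y ≡ (y ℤ.+ + 2 ℤ.* v) ℤ.- + 2 ℤ.* v
  unspin₂ = solve-∀

  restore : ∀ x y → x ≡ + 2 ℤ.* y ℤ.+ (x ℤ.- + 2 ℤ.* y)
  restore = solve-∀

  difference-of-multiples : ∀ a b → a ℤ.* + 5 ℤ.- b ℤ.* + 5 ≡ (a ℤ.- b) ℤ.* + 5
  difference-of-multiples = solve-∀

  x-combination : ∀ x y → x ≡ x ℤ.* + 5 ℤ.- + 2 ℤ.* ((x ℤ.- + 2 ℤ.* y) ℤ.+ (x ℤ.+ + 2 ℤ.* y))
  x-combination = solve-∀

  y-combination : ∀ x y → y ≡ y ℤ.* + 5 ℤ.- ((x ℤ.+ + 2 ℤ.* y) ℤ.- (x ℤ.- + 2 ℤ.* y))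
  y-combination = solve-∀

  x-multiple : ∀ x s t → x ℤ.* + 5 ℤ.- + 2 ℤ.* (s ℤ.* + 5 ℤ.+ t ℤ.* + 5) ≡ (x ℤ.- + 2 ℤ.* (s ℤ.+ t)) ℤ.* + 5
  x-multiple = solve-∀

  y-multiple : ∀ y s t → y ℤ.* + 5 ℤ.- (t ℤ.* + 5 ℤ.- s ℤ.* + 5) ≡ (y ℤ.- (t ℤ.- s)) ℤ.* + 5
  y-multiple = solve-∀

  conj-- : ∀ x y → x ℤ.+ + 2 ℤ.* (ℤ.- y) ≡ x ℤ.- + 2 ℤ.* y
  conj-- = solve-∀

  conj-+ : ∀ x y → x ℤ.- + 2 ℤ.* (ℤ.- y) ≡ x ℤ.+ + 2 ℤ.* y
  conj-+ = solve-∀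

  square-5 : ∀ a → (a * 5) * (a * 5) ≡ (a * a) * 5 * 5
  square-5 = ℕ-Solver.solve-∀

  -- Divisibility of x + i y by 2 + i and by 2 - i: modulo 2 + i the unit i is -2, which leaves x -
  -- 2 y in the field of 5 elements, and modulo 2 - i it is 2.
  DividesMinus DividesPlus : ℤ × ℤ → Set
  DividesMinus (x , y) = 5∣ x ℤ.- + 2 ℤ.* y
  DividesPlus  (x , y) = 5∣ x ℤ.+ + 2 ℤ.* y

  norm-divisible : ∀ {n} z → norm z ≡ n * 5 → DividesMinus z ⊎ DividesPlus z
  norm-divisible {n} (x , y) eq = 5∣*⇒ _ _ (divides (+ n ℤ.- y ℤ.* y) (begin
    (x ℤ.- + 2 ℤ.* y) ℤ.* (x ℤ.+ + 2 ℤ.* y)    ≡⟨ normℤ-factor x y ⟩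
    normℤ (x , y) ℤ.- y ℤ.* y ℤ.* + 5          ≡⟨ cong (ℤ._- y ℤ.* y ℤ.* + 5) (+norm (x , y)) ⟨
    + norm (x , y) ℤ.- y ℤ.* y ℤ.* + 5         ≡⟨ cong (λ k → + k ℤ.- y ℤ.* y ℤ.* + 5) eq ⟩
    + (n * 5) ℤ.- y ℤ.* y ℤ.* + 5              ≡⟨ cong (ℤ._- y ℤ.* y ℤ.* + 5) (ℤ.pos-* n 5) ⟩
    + n ℤ.* + 5 ℤ.- y ℤ.* y ℤ.* + 5            ≡⟨ difference-of-multiples (+ n) (y ℤ.* y) ⟩
    (+ n ℤ.- y ℤ.* y) ℤ.* + 5                  ∎))
    where open ≡-Reasoning

  norm-spin : ∀ z → norm (spin z) ≡ norm z * 5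
  norm-spin z = norm-via-ℤ {spin z} {z} (normℤ-spin (proj₁ z) (proj₂ z))

  spin-injective : ∀ {z w} → spin z ≡ spin w → z ≡ w
  spin-injective {u , v} {u′ , v′} eq with ,-injective eq
  ... | eq₁ , eq₂ = cong₂ _,_
    (ℤ.*-cancelʳ-≡ u u′ (+ 5) (trans (5*proj₁ u v) (trans (cong₂ (λ a b → + 2 ℤ.* a ℤ.+ b) eq₁ eq₂) (sym (5*proj₁ u′ v′)))))
    (ℤ.*-cancelʳ-≡ v v′ (+ 5) (trans (sym (5*proj₂ u v)) (trans (cong₂ (λ a b → a ℤ.- + 2 ℤ.* b) eq₁ eq₂) (5*proj₂ u′ v′))))

  spin-surjective : ∀ z → DividesMinus z → ∃ λ w → z ≡ spin w
  -- Here v is (x - 2 y) / 5, and the first coordinate u solves y = u - 2 v.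
  spin-surjective (x , y) (divides v eq) = (y ℤ.+ + 2 ℤ.* v , v) , cong₂ _,_
    (trans (restore x y) (trans (cong (λ k → + 2 ℤ.* y ℤ.+ k) eq) (sym (unspin₁ y v)))) (unspin₂ y v)

  conj : ℤ × ℤ → ℤ × ℤ
  conj (x , y) = x , ℤ.- y

  norm-conj : ∀ z → norm (conj z) ≡ norm z
  norm-conj (x , y) = cong (λ k → square x + k * k) (ℤ.∣-i∣≡∣i∣ y)

  conj-involutive : ∀ z → conj (conj z) ≡ z
  conj-involutive (x , y) = cong (x ,_) (ℤ.neg-involutive y)

  -- `spin` multiplies norms by 5, and its image is exactly the multiples of 2 + i.
  counts-minus : ∀ n → Counts (λ z → norm z ≡ n * 5 × DividesMinus z) ((theta ⊗ theta) n)
  counts-minus n = counts-image spin spin-injective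
    (λ {z} eq → trans (norm-spin z) (cong (_* 5) eq) , divides (proj₂ z) (5*proj₂ (proj₁ z) (proj₂ z)))
    (λ (eq , d) → let (w , z≡) = spin-surjective _ d in
       w , *-cancelʳ-≡ _ _ 5 (trans (sym (norm-spin w)) (trans (cong norm (sym z≡)) eq)) , z≡)
    (counts-theta² n)

  counts-plus : ∀ n → Counts (λ z → norm z ≡ n * 5 × DividesPlus z) ((theta ⊗ theta) n)
  counts-plus n = counts-image conj
    (λ {z} {w} eq → trans (sym (conj-involutive z)) (trans (cong conj eq) (conj-involutive w)))
    (λ {z} (eq , d) → trans (norm-conj z) eq , subst 5∣_ (sym (conj-- (proj₁ z) (proj₂ z))) d)
    (λ {z} (eq , d) → conj z ,
      (trans (norm-conj z) eq , subst 5∣_ (sym (conj-+ (proj₁ z) (proj₂ z))) d) , sym (conj-involutive z))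
    (counts-minus n)

  -- Both coordinates are multiples of 5, so 25 divides the norm 5 n. Hence n = 5 m, and dividing by
  -- 5 gives the points of norm m.
  counts-both : ∀ n → Counts (λ z → (norm z ≡ n * 5 × DividesPlus z) × DividesMinus z) (V (theta ⊗ theta) n)
  counts-both n = counts-image scale scale-injective (λ {z} → to {z}) from (counts-V counts-theta² n)
    where
    scale : ℤ × ℤ → ℤ × ℤ
    scale (x , y) = x ℤ.* + 5 , y ℤ.* + 5
    scale-injective : ∀ {z w} → scale z ≡ scale w → z ≡ w
    scale-injective eq with ,-injective eq
    ... | eq₁ , eq₂ = cong₂ _,_ (ℤ.*-cancelʳ-≡ _ _ (+ 5) eq₁) (ℤ.*-cancelʳ-≡ _ _ (+ 5) eq₂)
    norm-scale : ∀ z → norm (scale z) ≡ norm z * 5 * 5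
    norm-scale z = trans (norm-via-ℤ {scale z} {z} (normℤ-5 (proj₁ z) (proj₂ z))) (sym (*-assoc (norm z) 5 5))
    to : ∀ {z} → (∃ λ m → n ≡ m * 5 × norm z ≡ m) →
         (norm (scale z) ≡ n * 5 × DividesPlus (scale z)) × DividesMinus (scale z)
    to {z@(x , y)} (m , refl , refl) = (norm-scale z , divides (x ℤ.+ + 2 ℤ.* y) (plus x y)) ,
      divides (x ℤ.- + 2 ℤ.* y) (minus x y)
      where
      plus : ∀ x y → x ℤ.* + 5 ℤ.+ + 2 ℤ.* (y ℤ.* + 5) ≡ (x ℤ.+ + 2 ℤ.* y) ℤ.* + 5
      plus = solve-∀
      minus : ∀ x y → x ℤ.* + 5 ℤ.- + 2 ℤ.* (y ℤ.* + 5) ≡ (x ℤ.- + 2 ℤ.* y) ℤ.* + 5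
      minus = solve-∀
    from : ∀ {z} → (norm z ≡ n * 5 × DividesPlus z) × DividesMinus z →
           ∃ λ w → (∃ λ m → n ≡ m * 5 × norm w ≡ m) × z ≡ scale w
    from {x , y} ((eq , divides t eq₊) , divides s eq₋) = w , (norm w , n≡ , refl) , z≡
      where
      -- From x = 5 x - 2 (2 x) and y = 5 y - 4 y, where 2 x and 4 y are the sum and the difference
      -- of x + 2 y = 5 t and x - 2 y = 5 s.
      w = x ℤ.- + 2 ℤ.* (s ℤ.+ t) , y ℤ.- (t ℤ.- s)
      z≡ : (x , y) ≡ scale w
      z≡ = cong₂ _,_
        (trans (x-combination x y) (trans (cong₂ (λ a b → x ℤ.* + 5 ℤ.- + 2 ℤ.* (a ℤ.+ b)) eq₋ eq₊) (x-multiple x s t)))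
        (trans (y-combination x y) (trans (cong₂ (λ a b → y ℤ.* + 5 ℤ.- (b ℤ.- a)) eq₋ eq₊) (y-multiple y s t)))
      n≡ : n ≡ norm w * 5
      n≡ = *-cancelʳ-≡ _ _ 5 (trans (sym eq) (trans (cong norm z≡) (norm-scale w)))

  theta²-hecke : ∀ n → (theta ⊗ theta) (n * 5) + V (theta ⊗ theta) n ≡ (theta ⊗ theta) n + (theta ⊗ theta) n
  theta²-hecke n = inclusion-exclusion (λ z → + 5 ℤ∣.∣? _) (λ {z} → norm-divisible {n} z)
    (counts-theta² (n * 5)) (counts-minus n) (counts-plus n) (counts-both n)

  -- A root of 5 n is a multiple 5 y of 5, and then n = 5 y².
  theta-5n : ∀ n → theta (n * 5) ≡ V theta n
  theta-5n n = counts-unique (counts-theta (n * 5))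
    (counts-image (ℤ._* + 5) (ℤ.*-cancelʳ-≡ _ _ (+ 5)) (λ {x} → to {x}) (λ {x} → from {x}) (counts-V counts-theta n))
    where
    square-scale : ∀ x → square (x ℤ.* + 5) ≡ square x * 5 * 5
    square-scale x = trans (cong (λ k → k * k) (ℤ.abs-* x (+ 5))) (square-5 ∣ x ∣)
    to : ∀ {x} → (∃ λ m → n ≡ m * 5 × square x ≡ m) → square (x ℤ.* + 5) ≡ n * 5
    to {x} (_ , refl , refl) = square-scale x
    from : ∀ {x} → square x ≡ n * 5 → ∃ λ y → (∃ λ m → n ≡ m * 5 × square y ≡ m) × x ≡ y ℤ.* + 5
    from {x} eq with [ (λ d → d) , (λ d → d) ]′ (5∣*⇒ x x (∣ᵤ⇒∣ (ℕ∣.divides n (trans (ℤ.abs-* x x) eq))))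
    ... | divides y refl = y , (square y , *-cancelʳ-≡ _ _ 5 (trans (sym eq) (square-scale y)) , refl) , refl

  square-mod-5 : ∀ k → (k * k) % 5 ≢ 2 × (k * k) % 5 ≢ 3
  square-mod-5 k = subst (λ r → r ≢ 2 × r ≢ 3) (sym (%-distribˡ-* k k 5)) (residue (k % 5) (m%n<n k 5))
    where
    residue : ∀ r → r < 5 → (r * r) % 5 ≢ 2 × (r * r) % 5 ≢ 3
    residue 0 _ = (λ ()) , (λ ())
    residue 1 _ = (λ ()) , (λ ())
    residue 2 _ = (λ ()) , (λ ())
    residue 3 _ = (λ ()) , (λ ())
    residue 4 _ = (λ ()) , (λ ())
    residue (suc (suc (suc (suc (suc _))))) (s≤s (s≤s (s≤s (s≤s (s≤s ())))))

  theta-5n+2 : ∀ n → theta (2 + n * 5) ≡ 0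
  theta-5n+2 n = counts-unique (counts-theta (2 + n * 5)) (counts-∅ λ {x} eq →
    proj₁ (square-mod-5 ∣ x ∣) (trans (cong (_% 5) eq) ([m+kn]%n≡m%n 2 n 5)))

  theta-5n+3 : ∀ n → theta (3 + n * 5) ≡ 0
  theta-5n+3 n = counts-unique (counts-theta (3 + n * 5)) (counts-∅ λ {x} eq →
    proj₂ (square-mod-5 ∣ x ∣) (trans (cong (_% 5) eq) ([m+kn]%n≡m%n 3 n 5)))

-- Specialization to overpartitions modulo 5

open import Defs
open import Data.Nat using (ℕ; zero; suc; _*_; _^_; _%_; s≤s; _<_)
open import Data.Nat.DivMod using (m%n<n; m%n%n≡m%n)
import Data.Nat.Tactic.RingSolver as ℕ-Solver
open import Relation.Binary.PropositionalEquality
open OverpartitionCounts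
open LatticePoints

private
  module ℤ/5 = CommutativeRing (ℤ/suc 4)

  5≈0 : CharacteristicDivides 5 (PowerSeries.commutativeRing (ℤ/suc 4))
  5≈0 zero    = refl
  5≈0 (suc _) = refl

  module F = FiveDissection (ℤ/suc 4) 5≈0
  open GaussIdentity (ℤ/suc 4) 5≈0 using (gauss)
  open import Algebra.Properties.Semiring.Exp ℤ/5.semiring using () renaming (_^_ to _^₅_; ^-congˡ to ^₅-congˡ)

fermat : ∀ a → a ^₅ 5 ℤ/5.≈ a
fermat a = trans (^₅-congˡ 5 {x = a} {y = a % 5} (sym (m%n%n≡m%n a 5)))
  (trans (residue (a % 5) (m%n<n a 5)) (m%n%n≡m%n a 5))
  where
  residue : ∀ r → r < 5 → r ^₅ 5 ℤ/5.≈ r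
  residue 0 _ = refl
  residue 1 _ = refl
  residue 2 _ = refl
  residue 3 _ = refl
  residue 4 _ = refl
  residue (suc (suc (suc (suc (suc _))))) (s≤s (s≤s (s≤s (s≤s (s≤s ())))))

#bounded-zero : #bounded 0 F.≈ F.1#
#bounded-zero zero    = cong (_% 5) #bounded-0-0
#bounded-zero (suc m) = cong (_% 5) (#bounded-0-suc m)

-- 4 is -1 modulo 5. The series `H n` of `gauss` belongs to lists that follow a part of size n + 1,
-- hence the offset in `#follows`.
twisted-p̄*theta≈1 : F.twist 4 p̄ F.* theta F.≈ F.1#
twisted-p̄*theta≈1 = gauss {#bounded} {λ n → #follows (suc n)} {p̄} {theta} #bounded-zero
  (λ n m → cong (_% 5) (#bounded-suc n m))
  (λ n m → cong (_% 5) (#follows-suc n m))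
  (λ m≤n → cong (_% 5) (#bounded-p̄ m≤n))
  (λ m≤n → cong (_% 5) (truncatedTheta-theta m≤n))

U⁴-p̄ : F.U (F.U (F.U (F.U p̄))) F.≈ F.U (F.U p̄)
-- The two `refl` compute 4² to 1 and 4⁵ to 4 modulo 5.
U⁴-p̄ = F.untwist-U⁴ {4} refl refl p̄ (F.U⁴-Q fermat {theta} {F.twist 4 p̄} twisted-p̄*theta≈1
  (λ n → cong (_% 5) (theta-5n n))
  (λ n → cong (_% 5) (theta²-hecke n))
  (λ n → cong (_% 5) (theta-5n+2 n))
  (λ n → cong (_% 5) (theta-5n+3 n)))

25n : ∀ n → 5 ^ 2 * n ≡ n * 5 * 5
25n = ℕ-Solver.solve-∀

625n : ∀ n → 5 ^ 4 * n ≡ n * 5 * 5 * 5 * 5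
625n = ℕ-Solver.solve-∀

theorem1p5 : (n : ℕ) → p̄ (5 ^ 2 * n) % 5 ≡ p̄ (5 ^ 4 * n) % 5
theorem1p5 n = trans (cong (λ k → p̄ k % 5) (25n n)) (trans (sym (U⁴-p̄ n)) (cong (λ k → p̄ k % 5) (sym (625n n))))
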